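{- Let $p$ be a prime, let $n\ge 3$ and $j\ge 2$ be integers, and let $\Gamma=\mathbb{Z}_p^j$. For each integer $i$ with $1\le i\le j$, there is a rank-$i$ lift $M$ of the graphic matroid $M(K_n^{\Gamma})$ so that a cycle of $K_n^{\Gamma}$ is a circuit of $M$ if and only if it is balanced.
   Context: $\mathbb{Z}_p^j$ is the direct sum of $j$ copies of the cyclic group of order $p$. For a finite group $\Gamma$ and integer $n\ge 3$, $K_n^{\Gamma}$ is the (multi)graph with vertex set $[n]=\{1,\dots,n\}$ and edge set $\binom{[n]}{2}\times\Gamma$, where the edge $(\{i,j\},\alpha)$ joins vertices $i$ and $j$. For $i<j$ the edge $e=(\{i,j\},\alpha)$ is oriented from $i$ to $j$ and has label $\phi(e)=\alpha$. For a walk $W$ with edge sequence $e_1,\dots,e_k$, put $\phi(W)=\prod_{t=1}^k\phi(e_t)^{c_t}$ (group written multiplicatively), where $c_t=1$ if $e_t$ is traversed forward in $W$ and $c_t=-1$ if it is traversed backward. A cycle $C$ of $K_n^{\Gamma}$ (including cycles consisting of two parallel edges) is balanced if some (equivalently, every) simple closed walk $W$ around $C$ has $\phi(W)$ equal to the identity of $\Gamma$. Cycles are identified with their edge sets. $M(G)$ is the graphic (cycle) matroid of a graph $G$. A matroid $K$ is a lift of a matroid $M$ if there is a matroid $P$ and a subset $X$ of $E(P)$ so that $P\setminus X=K$ and $P/X=M$. If $r(K)-r(M)=k$, then $K$ is a rank-$k$ lift of $M$. -}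

module Defs where

open import Algebra.Structures using (IsGroup)
open import Data.Fin as Fin using (Fin; zero; suc; toℕ; fromℕ<)
open import Data.Fin.Properties using (toℕ-fromℕ<; toℕ-injective; toℕ<n; +↔⊎; *↔×)
open import Data.Fin.Subset using (Subset; ⊥; ⊤; _∪_; _∩_; _⊆_; _⊂_; ∣_∣; ⁅_⁆; ⋃)
open import Data.List as List using (List)
open import Data.List.Relation.Unary.Unique.Propositional using (Unique)
open import Data.Nat using (ℕ; zero; suc; _+_; _*_; _∸_; _^_; _≤_; _<_; z≤n; s≤s; NonZero; ≢-nonZero⁻¹)
open import Data.Nat.DivMod using (_%_; m%n<n; m<n⇒m%n≡m; m%n%n≡m%n; %-distribˡ-+; n%n≡0)
open import Data.Nat.Properties using (+-assoc; +-comm; m∸n+n≡m; n≢0⇒n>0; <⇒≤)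
open import Data.Product using (Σ; ∃-syntax; _×_; _,_; proj₁; proj₂)
open import Data.Product.Function.NonDependent.Propositional using (_×-↔_)
open import Data.Sum using (_⊎_; inj₁; inj₂)
open import Data.Sum.Function.Propositional using (_⊎-↔_)
open import Data.Vec as Vec using (Vec; []; _∷_; _++_; zipWith; replicate)
open import Data.Vec.Properties using (zipWith-assoc; zipWith-identityˡ; zipWith-identityʳ; zipWith-inverseˡ; zipWith-inverseʳ)
open import Function.Bundles using (_↔_; _⇔_; mk↔ₛ′; Inverse)
open import Function.Construct.Composition using (_↔-∘_)
open import Function.Construct.Identity using (↔-id)
open import Relation.Binary.PropositionalEquality using (_≡_; _≢_; refl; sym; trans; cong; cong₂; isEquivalence; module ≡-Reasoning)

-- Matroids with ground set Fin m, given by their rank functions.  A matroid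
-- is determined by its rank function, so equality of matroids on the same
-- ground set is pointwise equality of ranks.
record Matroid (m : ℕ) : Set where
  field
    rank            : Subset m → ℕ
    rank-≤-size     : ∀ X → rank X ≤ ∣ X ∣
    rank-mono       : ∀ {X Y} → X ⊆ Y → rank X ≤ rank Y
    rank-submodular : ∀ X Y → rank (X ∪ Y) + rank (X ∩ Y) ≤ rank X + rank Y

open Matroid public using (rank)

-- Since rank X ≤ ∣ X ∣ always holds, X is independent when
-- rank X ≡ ∣ X ∣ and dependent when rank X < ∣ X ∣.
IsCircuit : ∀ {m} → Matroid m → Subset m → Set
IsCircuit M C = rank M C < ∣ C ∣ × (∀ D → D ⊂ C → rank M D ≡ ∣ D ∣)

-- For a matroid P on Fin (m + k), the set X to be removed consists of the
-- last k elements (no loss of generality, as elements may be renumbered),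
-- and Fin m is E(P) − X.  A subset of E(P) is Y ++ Z with Y ⊆ E(P) − X and
-- Z ⊆ X; in particular X itself is ⊥ ++ ⊤.

-- K = P \ X, where r_{P\X}(Y) = r_P(Y).
IsDeletion : ∀ {m} k → Matroid (m + k) → Matroid m → Set
IsDeletion {m} k P K = ∀ (Y : Subset m) → rank K Y ≡ rank P (Y ++ ⊥ {n = k})

-- M = P / X, where r_{P/X}(Y) = r_P(Y ∪ X) − r_P(X).
IsContraction : ∀ {m} k → Matroid (m + k) → Matroid m → Set
IsContraction {m} k P M =
  ∀ (Y : Subset m) → rank M Y ≡ rank P (Y ++ X) ∸ rank P (⊥ {n = m} ++ X)
  where
  X : Subset k
  X = ⊤

IsLift : ∀ {m} → Matroid m → Matroid m → Set
IsLift {m} K M = ∃[ k ] Σ (Matroid (m + k)) λ P → IsDeletion k P K × IsContraction k P M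

IsRankLift : ∀ {m} → ℕ → Matroid m → Matroid m → Set
IsRankLift i K M = IsLift K M × rank K ⊤ ≡ rank M ⊤ + i

-- Vertex set Fin n and edge set Fin m.  The orientation plays no role in
-- which edge sets are cycles.
record Multigraph (n m : ℕ) : Set where
  field
    source target : Fin m → Fin n

data Direction : Set where
  forward backward : Direction

module _ {n m : ℕ} (G : Multigraph n m) where
  open Multigraph G

  initial terminal : Direction → Fin m → Fin n
  initial  forward  = source
  initial  backward = target
  terminal forward  = target
  terminal backward = source

  data Walk : Fin n → Fin n → Set where
    stop : ∀ {u} → Walk u u
    step : ∀ {u w} (d : Direction) (e : Fin m) → initial d e ≡ u →
           Walk (terminal d e) w → Walk u w

module _ {n m : ℕ} {G : Multigraph n m} where

  edges : ∀ {u w} → Walk G u w → List (Fin m)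
  edges stop           = List.[]
  edges (step d e _ W) = e List.∷ edges W

  -- The final vertex of the walk is left out, so that a closed walk lists
  -- its base vertex once.
  vertices : ∀ {u w} → Walk G u w → List (Fin n)
  vertices stop                = List.[]
  vertices {u} (step d e _ W) = u List.∷ vertices W

  edgeSet : ∀ {u w} → Walk G u w → Subset m
  edgeSet W = ⋃ (List.map ⁅_⁆ (edges W))

  -- Distinctness of edges matters only for walks of length two, where it
  -- excludes traversing one edge back and forth.
  IsSimpleClosed : ∀ {v} → Walk G v v → Set
  IsSimpleClosed W = edges W ≢ List.[] × Unique (vertices W) × Unique (edges W)

module _ {n m : ℕ} (G : Multigraph n m) where

  IsWalkAround : ∀ {v} → Walk G v v → Subset m → Set
  IsWalkAround W C = IsSimpleClosed W × edgeSet W ≡ C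

  IsCycle : Subset m → Set
  IsCycle C = ∃[ v ] Σ (Walk G v v) λ W → IsWalkAround W C

  -- N = M(G): the matroid on the edges of G whose circuits are the cycles.
  IsCycleMatroid : Matroid m → Set
  IsCycleMatroid N = ∀ C → IsCircuit N C ⇔ IsCycle C

record FiniteGroup : Set₁ where
  infixl 7 _∙_
  infix  8 _⁻¹
  field
    Carrier   : Set
    _∙_       : Carrier → Carrier → Carrier
    ε         : Carrier
    _⁻¹       : Carrier → Carrier
    isGroup   : IsGroup _≡_ _∙_ ε _⁻¹
    order     : ℕ
    numbering : Fin order ↔ Carrier

module _ (Γ : FiniteGroup) {n m : ℕ} {G : Multigraph n m} where
  open FiniteGroup Γ

  walkLabel : (Fin m → Carrier) → ∀ {u w} → Walk G u w → Carrier
  walkLabel φ stop                  = ε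
  walkLabel φ (step forward  e _ W) = φ e ∙ walkLabel φ W
  walkLabel φ (step backward e _ W) = φ e ⁻¹ ∙ walkLabel φ W

module _ (Γ : FiniteGroup) {n m : ℕ} (G : Multigraph n m) where
  open FiniteGroup Γ

  IsBalanced : (Fin m → Carrier) → Subset m → Set
  IsBalanced φ C =
    ∃[ v ] Σ (Walk G v v) λ W → IsWalkAround G W C × walkLabel Γ φ W ≡ ε

-- A two-element subset {i , j} of the vertices is the pair (i , j) with i < j.
Pair : ℕ → Set
Pair n = Σ (Fin n × Fin n) λ (i , j) → i Fin.< j

pairCount : ℕ → ℕ
pairCount zero    = 0
pairCount (suc n) = n + pairCount n

splitPair : ∀ n → (Fin n ⊎ Pair n) ↔ Pair (suc n)
splitPair n = mk↔ₛ′ to from to∘from from∘to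
  where
  to : Fin n ⊎ Pair n → Pair (suc n)
  to (inj₁ j)               = (zero , suc j) , s≤s z≤n
  to (inj₂ ((i , j) , i<j)) = (suc i , suc j) , s≤s i<j

  from : Pair (suc n) → Fin n ⊎ Pair n
  from ((zero  , suc j) , _)       = inj₁ j
  from ((suc i , suc j) , s≤s i<j) = inj₂ ((i , j) , i<j)

  to∘from : ∀ x → to (from x) ≡ x
  to∘from ((zero  , suc j) , s≤s z≤n) = refl
  to∘from ((suc i , suc j) , s≤s i<j) = refl

  from∘to : ∀ x → from (to x) ≡ x
  from∘to (inj₁ j) = refl
  from∘to (inj₂ _) = refl

pairNumbering : ∀ n → Fin (pairCount n) ↔ Pair n
pairNumbering zero    = mk↔ₛ′ (λ ()) (λ { ((() , _) , _) }) (λ { ((() , _) , _) }) (λ ())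
pairNumbering (suc n) = splitPair n ↔-∘ ((↔-id (Fin n) ⊎-↔ pairNumbering n) ↔-∘ +↔⊎)

module _ (n : ℕ) (Γ : FiniteGroup) where
  open FiniteGroup Γ

  Edge : Set
  Edge = Pair n × Carrier

  edgeCount : ℕ
  edgeCount = pairCount n * order

  edgeNumbering : Fin edgeCount ↔ Edge
  edgeNumbering = (pairNumbering n ×-↔ numbering) ↔-∘ *↔×

  edge : Fin edgeCount → Edge
  edge = Inverse.to edgeNumbering

  K : Multigraph n edgeCount
  K = record
    { source = λ e → proj₁ (proj₁ (proj₁ (edge e)))
    ; target = λ e → proj₂ (proj₁ (proj₁ (edge e)))
    }

  label : Fin edgeCount → Carrier
  label e = proj₂ (edge e)

-- ℤ_p is Fin p with addition modulo p; ℤ_p^j is Vec (Fin p) j with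
-- componentwise operations.
module _ (p : ℕ) .{{_ : NonZero p}} where

  mod : ℕ → Fin p
  mod a = fromℕ< (m%n<n a p)

  toℕ-mod : ∀ a → toℕ (mod a) ≡ a % p
  toℕ-mod a = toℕ-fromℕ< (m%n<n a p)

  mod-cong : ∀ {a b} → a % p ≡ b % p → mod a ≡ mod b
  mod-cong {a} {b} eq = toℕ-injective (trans (toℕ-mod a) (trans eq (sym (toℕ-mod b))))

  mod-toℕ : ∀ x → mod (toℕ x) ≡ x
  mod-toℕ x = toℕ-injective (trans (toℕ-mod (toℕ x)) (m<n⇒m%n≡m (toℕ<n x)))

  infixl 6 _+ₚ_

  _+ₚ_ : Fin p → Fin p → Fin p
  x +ₚ y = mod (toℕ x + toℕ y)

  0ₚ : Fin p
  0ₚ = mod 0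

  -ₚ_ : Fin p → Fin p
  -ₚ x = mod (p ∸ toℕ x)

  mod-+ : ∀ a b → mod a +ₚ mod b ≡ mod (a + b)
  mod-+ a b = mod-cong (trans (cong₂ (λ s t → (s + t) % p) (toℕ-mod a) (toℕ-mod b))
                              (sym (%-distribˡ-+ a b p)))

  +ₚ-comm : ∀ x y → x +ₚ y ≡ y +ₚ x
  +ₚ-comm x y = cong mod (+-comm (toℕ x) (toℕ y))

  +ₚ-assoc : ∀ x y z → (x +ₚ y) +ₚ z ≡ x +ₚ (y +ₚ z)
  +ₚ-assoc x y z = begin
    mod (a + b) +ₚ z           ≡⟨ cong (mod (a + b) +ₚ_) (mod-toℕ z) ⟨
    mod (a + b) +ₚ mod c       ≡⟨ mod-+ (a + b) c ⟩
    mod (a + b + c)            ≡⟨ cong mod (+-assoc a b c) ⟩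
    mod (a + (b + c))          ≡⟨ mod-+ a (b + c) ⟨
    mod a +ₚ mod (b + c)       ≡⟨ cong (_+ₚ mod (b + c)) (mod-toℕ x) ⟩
    x +ₚ mod (b + c)           ∎
    where
    open ≡-Reasoning
    a = toℕ x
    b = toℕ y
    c = toℕ z

  +ₚ-identityˡ : ∀ x → 0ₚ +ₚ x ≡ x
  +ₚ-identityˡ x = begin
    mod 0 +ₚ x            ≡⟨ cong (mod 0 +ₚ_) (mod-toℕ x) ⟨
    mod 0 +ₚ mod (toℕ x)  ≡⟨ mod-+ 0 (toℕ x) ⟩
    mod (toℕ x)           ≡⟨ mod-toℕ x ⟩
    x                     ∎
    where open ≡-Reasoning

  +ₚ-identityʳ : ∀ x → x +ₚ 0ₚ ≡ x
  +ₚ-identityʳ x = trans (+ₚ-comm x 0ₚ) (+ₚ-identityˡ x)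

  +ₚ-inverseˡ : ∀ x → (-ₚ x) +ₚ x ≡ 0ₚ
  +ₚ-inverseˡ x = begin
    mod (p ∸ toℕ x) +ₚ x            ≡⟨ cong (mod (p ∸ toℕ x) +ₚ_) (mod-toℕ x) ⟨
    mod (p ∸ toℕ x) +ₚ mod (toℕ x)  ≡⟨ mod-+ (p ∸ toℕ x) (toℕ x) ⟩
    mod (p ∸ toℕ x + toℕ x)         ≡⟨ cong mod (m∸n+n≡m (<⇒≤ (toℕ<n x))) ⟩
    mod p                           ≡⟨ mod-cong (trans (n%n≡0 p) (sym (m<n⇒m%n≡m 0<p))) ⟩
    mod 0                           ∎
    where
    open ≡-Reasoning
    0<p : 0 < p
    0<p = n≢0⇒n>0 (≢-nonZero⁻¹ p)

  +ₚ-inverseʳ : ∀ x → x +ₚ (-ₚ x) ≡ 0ₚ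
  +ₚ-inverseʳ x = trans (+ₚ-comm x (-ₚ x)) (+ₚ-inverseˡ x)

  vecNumbering : ∀ j → Fin (p ^ j) ↔ Vec (Fin p) j
  vecNumbering zero    = mk↔ₛ′ (λ _ → []) (λ _ → zero) (λ { [] → refl }) (λ { zero → refl })
  vecNumbering (suc j) = cons ↔-∘ ((↔-id (Fin p) ×-↔ vecNumbering j) ↔-∘ *↔×)
    where
    cons : (Fin p × Vec (Fin p) j) ↔ Vec (Fin p) (suc j)
    cons = mk↔ₛ′ (λ (x , v) → x ∷ v) (λ { (x ∷ v) → x , v })
                 (λ { (x ∷ v) → refl }) (λ { (x , v) → refl })

  ℤₚ^ : ℕ → FiniteGroup
  ℤₚ^ j = record
    { Carrier   = Vec (Fin p) j
    ; _∙_       = zipWith _+ₚ_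
    ; ε         = replicate j 0ₚ
    ; _⁻¹       = Vec.map -ₚ_
    ; isGroup   = record
      { isMonoid = record
        { isSemigroup = record
          { isMagma = record
            { isEquivalence = isEquivalence
            ; ∙-cong        = cong₂ (zipWith _+ₚ_)
            }
          ; assoc = zipWith-assoc +ₚ-assoc
          }
        ; identity = zipWith-identityˡ +ₚ-identityˡ , zipWith-identityʳ +ₚ-identityʳ
        }
      ; inverse = zipWith-inverseˡ +ₚ-inverseˡ , zipWith-inverseʳ +ₚ-inverseʳ
      ; ⁻¹-cong = cong (Vec.map -ₚ_)
      }
    ; order     = p ^ j
    ; numbering = vecNumbering j
    }

{-# OPTIONS --safe #-}

-- Over 𝔽ₚ, send the edge e from s to t to the vector (χ_t − χ_s , φ e) of
-- 𝔽ₚⁿ ⊕ 𝔽ₚʲ.  The first components represent N = M(G); the full vectors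
-- represent a matroid L in which a cycle is dependent exactly when it is
-- balanced, and N is a quotient of L with r(L) = r(N) + j.  The i-th Higgs
-- lift r_i(X) = min (r_N(X) + i , r_L(X)) of N towards L is then a rank-i
-- lift of N, and since a cycle C has r_N(C) = ∣ C ∣ − 1, it has the same
-- balanced circuits as L for all i ≥ 1.
--
-- Linear algebra enters only through duality: e lies in the span of l when
-- every linear functional vanishing on l vanishes on e.  There are finitely
-- many functionals modulo p, so span is decidable, and the exchange property
-- follows by combining two functionals so as to cancel at a chosen vector.

module Submission where

open import Defs
import Algebra.Properties.CommutativeSemigroup as CommutativeSemigroupₚ
open import Data.Bool using (_∧_; _∨_)
open import Data.Empty using (⊥-elim)
open import Data.Fin as Fin using (Fin; zero; suc; toℕ; fromℕ<; _≟_)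
open import Data.Fin.Properties as Finₚ using (suc-injective; toℕ-fromℕ<; toℕ<n; toℕ-injective)
open import Data.Fin.Subset as Subset using (Subset; inside; outside; _∪_; _∩_; _─_; _-_; ⁅_⁆; _⊂_; ∣_∣)
open import Data.Fin.Subset.Properties as Subsetₚ
  using (p∩q⊆p; p∩q⊆q; x∈p∪q⁻; x∈p∪q⁺; x∈⁅x⁆; x∈⁅y⁆⇒x≡y; x∈p∧x≢y⇒x∈p-y; x∈p⇒∣p-x∣<∣p∣;
         p⊆q⇒∣p∣≤∣q∣; ∈⊤; drop-∷-⊆; ∣⊥∣≡0)
open import Data.List using (List; []; _∷_; _++_; length; filter; map; allFin)
open import Data.List.Membership.Propositional using (_∈_)
open import Data.List.Membership.Propositional.Properties
  using (∈-++⁺ˡ; ∈-++⁺ʳ; ∈-++⁻; ∈-map⁺; ∈-map⁻; ∈-filter⁺; ∈-filter⁻)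
open import Data.List.Properties using (length-map; length-tabulate)
open import Data.List.Relation.Binary.Permutation.Propositional using (_↭_; ↭-sym)
open import Data.List.Relation.Binary.Permutation.Propositional.Properties using (++-comm; ∈-resp-↭)
open import Data.List.Relation.Binary.Subset.Propositional using () renaming (_⊆_ to _⊑_)
open import Data.List.Relation.Unary.All as All using (All; []; _∷_)
import Data.List.Relation.Unary.All.Properties as Allₚ
open import Data.List.Relation.Unary.AllPairs using ([]; _∷_)
open import Data.List.Relation.Unary.Any as Any using (here; there)
open import Data.List.Relation.Unary.Unique.Propositional using (Unique)
import Data.List.Relation.Unary.Unique.Propositional.Properties as Uniqueₚ
open import Data.Nat using (ℕ; zero; suc; _+_; _∸_; _⊓_; _≤_; _<_; z≤n; s≤s; s≤s⁻¹; s<s⁻¹)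
open import Data.Nat.DivMod using (m<n⇒m%n≡m)
import Data.Nat.Divisibility as ℕ∣
open import Data.Nat.Primality using (Prime; prime⇒nonZero; euclidsLemma; ¬prime[1])
open import Data.Nat.Properties hiding (_≟_; suc-injective)
import Data.Nat.Solver as ℕ-Solver
open import Data.Product using (Σ; ∃; _×_; _,_; proj₁; proj₂)
open import Data.Sum as Sum using (_⊎_; inj₁; inj₂; [_,_])
open import Data.Vec as Vec using (Vec; []; _∷_; here; there; lookup; replicate; tabulate; zipWith; _[_]≔_)
open import Data.Vec.Properties as Vecₚ
  using (take-zipWith; drop-zipWith; lookup∘tabulate; lookup∘update; lookup∘update′; lookup-replicate)
open import Function using (_∘_)
open import Function.Bundles using (_⇔_; mk⇔; Inverse)
open import Relation.Binary.Construct.Closure.Equivalence using (EqClosure; symmetric; transitive)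
open import Relation.Binary.Construct.Closure.ReflexiveTransitive using (ε; _◅_)
open import Relation.Binary.Construct.Closure.Symmetric using (fwd; bwd)
open import Relation.Binary.PropositionalEquality hiding ([_])
open import Relation.Nullary using (Dec; yes; no; ¬_; contradiction; _→-dec_)
open import Relation.Nullary.Decidable using (map′; decidable-stable)

-- The Higgs lift is needed because a linear construction with only `i` extra coordinates would send
-- the labels through a homomorphism from 𝔽ₚʲ to 𝔽ₚⁱ. For `i < j` this has a nonzero kernel, and a
-- cycle whose gain lies in the kernel would become balanced. Taking a minimum of ranks cuts down
-- the extra rank while leaving every label as it is. Scalars are integers, and "vanishes" means "is
-- divisible by `p`". Linear combinations of functionals can thus be computed exactly in ℤ, and
-- exchange rests on Euclid's lemma instead of on inverses in 𝔽ₚ.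

private
  variable
    A : Set
    m : ℕ

-- The increment of a rank when one element is added, `P` being the statement that the element is
-- already spanned.
jump : {P : Set} → Dec P → ℕ
jump (yes _) = 0
jump (no  _) = 1

jump≤1 : {P : Set} (d : Dec P) → jump d ≤ 1
jump≤1 (yes _) = z≤n
jump≤1 (no  _) = s≤s z≤n

jump-antitone : {P Q : Set} (p : Dec P) (q : Dec Q) → (P → Q) → jump q ≤ jump p
jump-antitone _       (yes _) _ = z≤n
jump-antitone (yes x) (no ¬y) f = contradiction (f x) ¬y
jump-antitone (no _)  (no _)  _ = ≤-refl

jump-yes : {P : Set} (d : Dec P) → P → jump d ≡ 0
jump-yes (yes _) _ = refl
jump-yes (no ¬x) x = contradiction x ¬x

jump-no : {P : Set} (d : Dec P) → ¬ P → jump d ≡ 1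
jump-no (yes x) ¬x = contradiction x ¬x
jump-no (no _)  _  = refl

-- Matroids from closure operators with exchange

record ClosureSpace (A : Set) : Set₁ where
  infix 4 _⊢_ _⊢?_
  field
    _⊢_      : List A → A → Set
    _⊢?_     : ∀ l a → Dec (l ⊢ a)
    ∈⇒⊢      : ∀ {l a} → a ∈ l → l ⊢ a
    cut      : ∀ {l k a} → All (k ⊢_) l → l ⊢ a → k ⊢ a
    exchange : ∀ {l a b} → b ∷ l ⊢ a → ¬ l ⊢ a → a ∷ l ⊢ b

  weaken : ∀ {l k a} → l ⊑ k → l ⊢ a → k ⊢ a
  weaken l⊑k = cut (All.tabulate (∈⇒⊢ ∘ l⊑k))

  -- A greedy count from the right: an element contributes when the elements after it do not span
  -- it. That the order is immaterial is `listRank-↭`.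
  listRank : List A → ℕ
  listRank []      = 0
  listRank (a ∷ l) = jump (l ⊢? a) + listRank l

  listRank≤length : ∀ l → listRank l ≤ length l
  listRank≤length []      = z≤n
  listRank≤length (a ∷ l) = +-mono-≤ (jump≤1 (l ⊢? a)) (listRank≤length l)

  listRank-map-++ : {B : Set} (f : B → A) {z : List A} →
    (∀ {b k} → All (b ≢_) k → ¬ map f k ++ z ⊢ f b) →
    ∀ {l} → Unique l → listRank (map f l ++ z) ≡ length l + listRank z
  listRank-map-++ f     new []                = refl
  listRank-map-++ f {z} new {b ∷ l} (b∉ ∷ l!) =
    cong₂ _+_ (jump-no (map f l ++ z ⊢? f b) (new b∉)) (listRank-map-++ f new l!)

  private
    -- Both sides are the rank gained by adding `a` and `b` to `l`, in the two orders. Exchange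
    -- enters only in the last case, where neither is spanned by `l` but `a` brings `b` into the
    -- span.
    swap-≤ : ∀ l a b → jump (b ∷ l ⊢? a) + jump (l ⊢? b) ≤ jump (a ∷ l ⊢? b) + jump (l ⊢? a)
    swap-≤ l a b with l ⊢? a | l ⊢? b | a ∷ l ⊢? b
    ... | yes la | lb?    | alb? rewrite jump-yes (b ∷ l ⊢? a) (weaken there la) | +-identityʳ (jump alb?) =
      jump-antitone alb? lb? (cut (la ∷ All.tabulate ∈⇒⊢))
    ... | no _   | lb?    | no _    = +-mono-≤ (jump≤1 (b ∷ l ⊢? a)) (jump≤1 lb?)
    ... | no _   | yes _  | yes _   rewrite +-identityʳ (jump (b ∷ l ⊢? a)) = jump≤1 (b ∷ l ⊢? a)
    ... | no _   | no ¬lb | yes alb rewrite jump-yes (b ∷ l ⊢? a) (exchange alb ¬lb) = ≤-refl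

    jump-resp-↭ : ∀ {l k a} → l ↭ k → jump (l ⊢? a) ≡ jump (k ⊢? a)
    jump-resp-↭ {l} {k} {a} σ = ≤-antisym
      (jump-antitone (k ⊢? a) (l ⊢? a) (weaken (∈-resp-↭ (↭-sym σ))))
      (jump-antitone (l ⊢? a) (k ⊢? a) (weaken (∈-resp-↭ σ)))

  listRank-↭ : ∀ {l k} → l ↭ k → listRank l ≡ listRank k
  listRank-↭ _↭_.refl = refl
  listRank-↭ (_↭_.prep a σ) = cong₂ _+_ (jump-resp-↭ σ) (listRank-↭ σ)
  listRank-↭ {_ ∷ _ ∷ l} {_ ∷ _ ∷ k} (_↭_.swap a b σ) = begin
    jump (b ∷ l ⊢? a) + (jump (l ⊢? b) + listRank l)  ≡⟨ +-assoc (jump (b ∷ l ⊢? a)) _ _ ⟨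
    jump (b ∷ l ⊢? a) + jump (l ⊢? b) + listRank l    ≡⟨ cong (_+ listRank l) (≤-antisym (swap-≤ l a b) (swap-≤ l b a)) ⟩
    jump (a ∷ l ⊢? b) + jump (l ⊢? a) + listRank l    ≡⟨ +-assoc (jump (a ∷ l ⊢? b)) _ _ ⟩
    jump (a ∷ l ⊢? b) + (jump (l ⊢? a) + listRank l)  ≡⟨ cong₂ _+_ (jump-resp-↭ (_↭_.prep a σ)) (cong₂ _+_ (jump-resp-↭ σ) (listRank-↭ σ)) ⟩
    jump (a ∷ k ⊢? b) + (jump (k ⊢? a) + listRank k)  ∎
    where open ≡-Reasoning
  listRank-↭ (_↭_.trans σ τ) = trans (listRank-↭ σ) (listRank-↭ τ)

  listRank-++-closed : ∀ {l k} → All (k ⊢_) l → listRank (l ++ k) ≡ listRank k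
  listRank-++-closed []                      = refl
  listRank-++-closed {a ∷ l} {k} (ka ∷ kl)
    rewrite jump-yes (l ++ k ⊢? a) (weaken (∈-++⁺ʳ l) ka) = listRank-++-closed kl

  listRank-++ʳ : ∀ l k → listRank k ≤ listRank (l ++ k)
  listRank-++ʳ []      k = ≤-refl
  listRank-++ʳ (a ∷ l) k = ≤-trans (listRank-++ʳ l k) (m≤n+m _ _)

  listRank-closed : ∀ {l k} → All (k ⊢_) l → listRank l ≤ listRank k
  listRank-closed {l} {k} k⊢l = begin
    listRank l         ≤⟨ listRank-++ʳ k l ⟩
    listRank (k ++ l)  ≡⟨ listRank-↭ (++-comm k l) ⟩
    listRank (l ++ k)  ≡⟨ listRank-++-closed k⊢l ⟩
    listRank k         ∎
    where open ≤-Reasoning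

  listRank-⊑ : ∀ {l k} → l ⊑ k → listRank l ≤ listRank k
  listRank-⊑ l⊑k = listRank-closed (All.tabulate (∈⇒⊢ ∘ l⊑k))

  -- A shortfall of the greedy count means that some element is spanned by those after it. As `l`
  -- has no repetitions, that tail omits the element; this will keep the closing edge of a cycle off
  -- the path it closes.
  dependent⇒⊢ : ∀ {l} → Unique l → listRank l < length l →
                ∃ λ a → ∃ λ k → a ∈ l × k ⊑ l × ¬ a ∈ k × k ⊢ a
  dependent⇒⊢ {a ∷ l} (a∉l ∷ l!) r< with l ⊢? a
  ... | yes la = a , l , here refl , there , (λ a∈l → All.lookup a∉l a∈l refl) , la
  ... | no  _  with b , k , b∈l , k⊑l , b∉k , kb ← dependent⇒⊢ l! (s<s⁻¹ r<)
    = b , k , there b∈l , there ∘ k⊑l , b∉k , kb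

module _ where
  open ClosureSpace

  -- Closures in `𝓜` lie inside closures in `𝓝`, which is the closure form of "`𝓝` is a quotient of
  -- `𝓜`".
  _⇛_ : ClosureSpace A → ClosureSpace A → Set
  𝓜 ⇛ 𝓝 = ∀ {l a} → _⊢_ 𝓜 l a → _⊢_ 𝓝 l a

  listRank-⇛ : {𝓜 𝓝 : ClosureSpace A} → 𝓜 ⇛ 𝓝 → ∀ l → listRank 𝓝 l ≤ listRank 𝓜 l
  listRank-⇛             𝓜⇛𝓝 []      = z≤n
  listRank-⇛ {𝓜 = 𝓜} {𝓝} 𝓜⇛𝓝 (a ∷ l) =
    +-mono-≤ (jump-antitone (_⊢?_ 𝓜 l a) (_⊢?_ 𝓝 l a) 𝓜⇛𝓝) (listRank-⇛ {𝓜 = 𝓜} {𝓝} 𝓜⇛𝓝 l)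

  -- Adding a to a larger set raises the rank by less: 𝓜 = 𝓝 gives
  -- submodularity, and in general 𝓝 is a quotient of 𝓜.
  listRank-quotient : {𝓜 𝓝 : ClosureSpace A} → 𝓜 ⇛ 𝓝 → ∀ l {h k} → h ⊑ k →
    listRank 𝓝 (l ++ k) + listRank 𝓜 h ≤ listRank 𝓜 (l ++ h) + listRank 𝓝 k
  listRank-quotient {𝓜 = 𝓜} {𝓝} 𝓜⇛𝓝 [] {h} {k} h⊑k = ≤-reflexive (+-comm (listRank 𝓝 k) (listRank 𝓜 h))
  listRank-quotient {𝓜 = 𝓜} {𝓝} 𝓜⇛𝓝 (a ∷ l) {h} {k} h⊑k = begin
    x + listRank 𝓝 (l ++ k) + listRank 𝓜 h    ≡⟨ +-assoc x _ _ ⟩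
    x + (listRank 𝓝 (l ++ k) + listRank 𝓜 h)  ≤⟨ +-mono-≤ x≤y (listRank-quotient {𝓜 = 𝓜} {𝓝} 𝓜⇛𝓝 l h⊑k) ⟩
    y + (listRank 𝓜 (l ++ h) + listRank 𝓝 k)  ≡⟨ +-assoc y _ _ ⟨
    y + listRank 𝓜 (l ++ h) + listRank 𝓝 k    ∎
    where
    open ≤-Reasoning
    x = jump (_⊢?_ 𝓝 (l ++ k) a)
    y = jump (_⊢?_ 𝓜 (l ++ h) a)
    x≤y : x ≤ y
    x≤y = jump-antitone _ _ (weaken 𝓝 ([ ∈-++⁺ˡ , ∈-++⁺ʳ l ∘ h⊑k ] ∘ ∈-++⁻ l) ∘ 𝓜⇛𝓝)

  -- From closure spaces to matroids on subsets

  elements : Subset m → List (Fin m)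
  elements []            = []
  elements (outside ∷ X) = map suc (elements X)
  elements (inside  ∷ X) = zero ∷ map suc (elements X)

  length-elements : (X : Subset m) → length (elements X) ≡ ∣ X ∣
  length-elements []            = refl
  length-elements (outside ∷ X) = trans (length-map suc (elements X)) (length-elements X)
  length-elements (inside  ∷ X) = cong suc (trans (length-map suc (elements X)) (length-elements X))

  ∈-elements⁺ : ∀ {e} {X : Subset m} → e Subset.∈ X → e ∈ elements X
  ∈-elements⁺ {X = inside  ∷ _} here        = here refl
  ∈-elements⁺ {X = inside  ∷ _} (there e∈X) = there (∈-map⁺ suc (∈-elements⁺ e∈X))
  ∈-elements⁺ {X = outside ∷ _} (there e∈X) = ∈-map⁺ suc (∈-elements⁺ e∈X)

  ∈-elements⁻ : ∀ {e} (X : Subset m) → e ∈ elements X → e Subset.∈ X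
  ∈-elements⁻ (inside  ∷ X) (here refl) = here
  ∈-elements⁻ (inside  ∷ X) (there e∈)  with _ , e∈X , refl ← ∈-map⁻ suc e∈ = there (∈-elements⁻ X e∈X)
  ∈-elements⁻ (outside ∷ X) e∈          with _ , e∈X , refl ← ∈-map⁻ suc e∈ = there (∈-elements⁻ X e∈X)

  elements-unique : (X : Subset m) → Unique (elements X)
  elements-unique []            = []
  elements-unique (outside ∷ X) = Uniqueₚ.map⁺ suc-injective (elements-unique X)
  elements-unique (inside  ∷ X) = All.tabulate zero∉ ∷ Uniqueₚ.map⁺ suc-injective (elements-unique X)
    where
    zero∉ : ∀ {e} → e ∈ map suc (elements X) → zero ≢ e
    zero∉ e∈ refl with () ← proj₂ (proj₂ (∈-map⁻ suc e∈))

  elements-⊑ : {X Y : Subset m} → X Subset.⊆ Y → elements X ⊑ elements Y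
  elements-⊑ {X = X} X⊆Y = ∈-elements⁺ ∘ X⊆Y ∘ ∈-elements⁻ X

  matroid : ClosureSpace (Fin m) → Matroid m
  matroid 𝓜 = record
    { rank            = λ X → listRank 𝓜 (elements X)
    ; rank-≤-size     = λ X → ≤-trans (listRank≤length 𝓜 (elements X)) (≤-reflexive (length-elements X))
    ; rank-mono       = λ X⊆Y → listRank-⊑ 𝓜 (elements-⊑ X⊆Y)
    ; rank-submodular = submodular
    }
    where
    submodular : ∀ X Y → listRank 𝓜 (elements (X ∪ Y)) + listRank 𝓜 (elements (X ∩ Y))
                       ≤ listRank 𝓜 (elements X) + listRank 𝓜 (elements Y)
    submodular X Y = begin
      listRank 𝓜 (elements (X ∪ Y)) + r∩                     ≤⟨ +-monoˡ-≤ r∩ (listRank-⊑ 𝓜 ∪⊑++) ⟩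
      listRank 𝓜 (elements X ++ elements Y) + r∩             ≤⟨ listRank-quotient {𝓜 = 𝓜} {𝓜} (λ l⊢a → l⊢a) (elements X) (elements-⊑ (p∩q⊆q X Y)) ⟩
      listRank 𝓜 (elements X ++ elements (X ∩ Y)) + rY       ≤⟨ +-monoˡ-≤ rY (listRank-⊑ 𝓜 ++⊑X) ⟩
      listRank 𝓜 (elements X) + rY                           ∎
      where
      open ≤-Reasoning
      r∩ = listRank 𝓜 (elements (X ∩ Y))
      rY = listRank 𝓜 (elements Y)
      ∪⊑++ : elements (X ∪ Y) ⊑ elements X ++ elements Y
      ∪⊑++ = [ ∈-++⁺ˡ ∘ ∈-elements⁺ , ∈-++⁺ʳ (elements X) ∘ ∈-elements⁺ ] ∘ x∈p∪q⁻ X Y ∘ ∈-elements⁻ (X ∪ Y)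
      ++⊑X : elements X ++ elements (X ∩ Y) ⊑ elements X
      ++⊑X = [ (λ e∈ → e∈) , elements-⊑ (p∩q⊆p X Y) ] ∘ ∈-++⁻ (elements X)

  -- The inequality r_N(Y) - r_N(X) ≤ r_M(Y) - r_M(X), rearranged to avoid subtraction in ℕ.
  IsQuotient : Matroid m → Matroid m → Set
  IsQuotient N M = ∀ {X Y} → X Subset.⊆ Y → rank N Y + rank M X ≤ rank M Y + rank N X

  matroid-quotient : {𝓜 𝓝 : ClosureSpace (Fin m)} → 𝓜 ⇛ 𝓝 → IsQuotient (matroid 𝓝) (matroid 𝓜)
  matroid-quotient {𝓜 = 𝓜} {𝓝} 𝓜⇛𝓝 {X} {Y} X⊆Y = begin
    listRank 𝓝 (elements Y) + rX                ≤⟨ +-monoˡ-≤ rX (listRank-⊑ 𝓝 {elements Y} ∈-++⁺ˡ) ⟩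
    listRank 𝓝 (elements Y ++ elements X) + rX  ≤⟨ listRank-quotient {𝓜 = 𝓜} {𝓝} 𝓜⇛𝓝 (elements Y) (λ e∈ → e∈) ⟩
    listRank 𝓜 (elements Y ++ elements X) + r′X ≤⟨ +-monoˡ-≤ r′X (listRank-⊑ 𝓜 ([ (λ e∈ → e∈) , elements-⊑ X⊆Y ] ∘ ∈-++⁻ (elements Y))) ⟩
    listRank 𝓜 (elements Y) + r′X               ∎
    where
    open ≤-Reasoning
    rX  = listRank 𝓜 (elements X)
    r′X = listRank 𝓝 (elements X)

quotient-rank-≤ : {N M : Matroid m} → IsQuotient N M → ∀ X → rank N X ≤ rank M X
quotient-rank-≤ {m} {N} {M} quo X = begin
  rank N X                    ≤⟨ m≤m+n _ _ ⟩
  rank N X + rank M Subset.⊥  ≤⟨ quo (λ e∈ → ⊥-elim (Subsetₚ.∉⊥ e∈)) ⟩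
  rank M X + rank N Subset.⊥  ≡⟨ cong (λ r → rank M X + r) (n≤0⇒n≡0 (≤-trans (Matroid.rank-≤-size N Subset.⊥) (≤-reflexive (∣⊥∣≡0 m)))) ⟩
  rank M X + 0                ≡⟨ +-identityʳ _ ⟩
  rank M X                    ∎
  where open ≤-Reasoning

-- Higgs lifts

higgs : (N M : Matroid m) → IsQuotient N M → ℕ → Matroid m
higgs {m} N M quo i = record
  { rank            = r
  ; rank-≤-size     = λ X → ≤-trans (m⊓n≤n (rank N X + i) (rank M X)) (Matroid.rank-≤-size M X)
  ; rank-mono       = λ X⊆Y → ⊓-mono-≤ (+-monoˡ-≤ i (Matroid.rank-mono N X⊆Y)) (Matroid.rank-mono M X⊆Y)
  ; rank-submodular = submodular
  }
  where
  open ≤-Reasoning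
  open ℕ-Solver.+-*-Solver
  r : Subset m → ℕ
  r X = (rank N X + i) ⊓ rank M X

  r≤N : ∀ X → r X ≤ rank N X + i
  r≤N X = m⊓n≤m _ _
  r≤M : ∀ X → r X ≤ rank M X
  r≤M X = m⊓n≤n (rank N X + i) _

  -- The union is bounded through `N` and the intersection through `M`. Submodularity of `N` leaves
  -- `rank N Y + rank M (X ∩ Y)`, which the quotient inequality for `X ∩ Y ⊆ Y` trades for
  -- `rank M Y + rank N (X ∩ Y)`; the term `rank N (X ∩ Y)`, added at the start for this purpose,
  -- then cancels.
  mixed : ∀ X Y → r (X ∪ Y) + r (X ∩ Y) ≤ (rank N X + i) + rank M Y
  mixed X Y = +-cancelʳ-≤ (rank N (X ∩ Y)) _ _ (begin
    r (X ∪ Y) + r (X ∩ Y) + n∩             ≤⟨ +-monoˡ-≤ n∩ (+-mono-≤ (r≤N (X ∪ Y)) (r≤M (X ∩ Y))) ⟩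
    (n∪ + i + m∩) + n∩                     ≡⟨ solve 4 (λ a b c d → a :+ b :+ c :+ d := a :+ d :+ b :+ c) refl n∪ i m∩ n∩ ⟩
    (n∪ + n∩ + i) + m∩                     ≤⟨ +-monoˡ-≤ m∩ (+-monoˡ-≤ i (Matroid.rank-submodular N X Y)) ⟩
    (rank N X + rank N Y + i) + m∩         ≡⟨ solve 4 (λ a b c d → a :+ b :+ c :+ d := a :+ c :+ (b :+ d)) refl (rank N X) (rank N Y) i m∩ ⟩
    (rank N X + i) + (rank N Y + m∩)       ≤⟨ +-monoʳ-≤ (rank N X + i) (quo (p∩q⊆q X Y)) ⟩
    (rank N X + i) + (rank M Y + n∩)       ≡⟨ +-assoc (rank N X + i) _ _ ⟨
    (rank N X + i) + rank M Y + n∩         ∎)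
    where
    n∪ = rank N (X ∪ Y)
    n∩ = rank N (X ∩ Y)
    m∩ = rank M (X ∩ Y)

  submodular : ∀ X Y → r (X ∪ Y) + r (X ∩ Y) ≤ r X + r Y
  submodular X Y with ⊓-sel (rank N X + i) (rank M X) | ⊓-sel (rank N Y + i) (rank M Y)
  ... | inj₁ p | inj₁ q rewrite p | q = begin
    r (X ∪ Y) + r (X ∩ Y)                              ≤⟨ +-mono-≤ (r≤N (X ∪ Y)) (r≤N (X ∩ Y)) ⟩
    (rank N (X ∪ Y) + i) + (rank N (X ∩ Y) + i)        ≡⟨ solve 3 (λ a b c → (a :+ c) :+ (b :+ c) := (a :+ b) :+ (c :+ c)) refl (rank N (X ∪ Y)) _ i ⟩
    (rank N (X ∪ Y) + rank N (X ∩ Y)) + (i + i)        ≤⟨ +-monoˡ-≤ (i + i) (Matroid.rank-submodular N X Y) ⟩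
    (rank N X + rank N Y) + (i + i)                    ≡⟨ solve 3 (λ a b c → (a :+ c) :+ (b :+ c) := (a :+ b) :+ (c :+ c)) refl (rank N X) _ i ⟨
    (rank N X + i) + (rank N Y + i)                    ∎
  ... | inj₁ p | inj₂ q rewrite p | q = mixed X Y
  ... | inj₂ p | inj₁ q rewrite p | q = begin
    r (X ∪ Y) + r (X ∩ Y)      ≡⟨ cong₂ (λ U V → r U + r V) (Subsetₚ.∪-comm X Y) (Subsetₚ.∩-comm X Y) ⟩
    r (Y ∪ X) + r (Y ∩ X)      ≤⟨ mixed Y X ⟩
    rank N Y + i + rank M X    ≡⟨ +-comm (rank N Y + i) _ ⟩
    rank M X + (rank N Y + i)  ∎
  ... | inj₂ p | inj₂ q rewrite p | q =
    ≤-trans (+-mono-≤ (r≤M (X ∪ Y)) (r≤M (X ∩ Y))) (Matroid.rank-submodular M X Y)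

higgs-full : {N M : Matroid m} (quo : IsQuotient N M) → ∀ i → rank N Subset.⊤ + i ≤ rank M Subset.⊤ →
             rank (higgs N M quo i) Subset.⊤ ≡ rank N Subset.⊤ + i
higgs-full quo i = m≤n⇒m⊓n≡m

-- Dependence comes from `M`, since the minimum is at most its rank. Proper subsets are independent
-- in both matroids, so both terms of the minimum reach their size.
higgs-circuit : {N M : Matroid m} (quo : IsQuotient N M) → ∀ i C →
                IsCircuit N C → IsCircuit M C → IsCircuit (higgs N M quo i) C
higgs-circuit {N = N} {M} quo i C (_ , proper-N) (dep-M , proper-M) =
  ≤-<-trans (m⊓n≤n (rank N C + i) (rank M C)) dep-M , λ D D⊂C →
    ≤-antisym (Matroid.rank-≤-size (higgs N M quo i) D)
              (⊓-glb (≤-trans (≤-reflexive (sym (proper-N D D⊂C))) (m≤m+n _ i))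
                     (≤-reflexive (sym (proper-M D D⊂C))))

higgs-non-circuit : {N M : Matroid m} (quo : IsQuotient N M) → ∀ {i} → 1 ≤ i → ∀ C →
                    ∣ C ∣ ≤ suc (rank N C) → ∣ C ∣ ≤ rank M C → ¬ IsCircuit (higgs N M quo i) C
higgs-non-circuit {N = N} {M} quo {i} 1≤i C ≤N ≤M (dep , _) = <⇒≱ dep (⊓-glb (begin
  ∣ C ∣           ≤⟨ ≤N ⟩
  suc (rank N C)  ≡⟨ +-comm 1 (rank N C) ⟩
  rank N C + 1    ≤⟨ +-monoʳ-≤ (rank N C) 1≤i ⟩
  rank N C + i    ∎) ≤M)
  where open ≤-Reasoning

-- Loops, coloops and the lift property

∣∪∣+∣∩∣ : (X Y : Subset m) → ∣ X ∪ Y ∣ + ∣ X ∩ Y ∣ ≡ ∣ X ∣ + ∣ Y ∣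
∣∪∣+∣∩∣ []            []            = refl
∣∪∣+∣∩∣ (inside  ∷ X) (inside  ∷ Y) = cong suc (begin
  ∣ X ∪ Y ∣ + suc ∣ X ∩ Y ∣    ≡⟨ +-suc _ _ ⟩
  suc (∣ X ∪ Y ∣ + ∣ X ∩ Y ∣)  ≡⟨ cong suc (∣∪∣+∣∩∣ X Y) ⟩
  suc (∣ X ∣ + ∣ Y ∣)          ≡⟨ +-suc _ _ ⟨
  ∣ X ∣ + suc ∣ Y ∣            ∎)
  where open ≡-Reasoning
∣∪∣+∣∩∣ (inside  ∷ X) (outside ∷ Y) = cong suc (∣∪∣+∣∩∣ X Y)
∣∪∣+∣∩∣ (outside ∷ X) (inside  ∷ Y) = trans (cong suc (∣∪∣+∣∩∣ X Y)) (sym (+-suc _ _))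
∣∪∣+∣∩∣ (outside ∷ X) (outside ∷ Y) = ∣∪∣+∣∩∣ X Y

take-⊆ : ∀ m {k} {X Y : Subset (m + k)} → X Subset.⊆ Y → Vec.take m X Subset.⊆ Vec.take m Y
take-⊆ (suc m) {X = _ ∷ _} {_ ∷ _} X⊆Y here with here ← X⊆Y here = here
take-⊆ (suc m) {X = _ ∷ _} {_ ∷ _} X⊆Y (there e∈) = there (take-⊆ m (drop-∷-⊆ X⊆Y) e∈)

drop-⊆ : ∀ m {k} {X Y : Subset (m + k)} → X Subset.⊆ Y → Vec.drop m X Subset.⊆ Vec.drop m Y
drop-⊆ zero    X⊆Y e∈ = X⊆Y e∈
drop-⊆ (suc m) {X = _ ∷ _} {_ ∷ _} X⊆Y e∈ = drop-⊆ m (drop-∷-⊆ X⊆Y) e∈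

take-++ : ∀ {k} (X : Subset m) (Y : Subset k) → Vec.take m (X Vec.++ Y) ≡ X
take-++ []      Y = refl
take-++ (x ∷ X) Y = cong (x ∷_) (take-++ X Y)

drop-++ : ∀ {k} (X : Subset m) (Y : Subset k) → Vec.drop m (X Vec.++ Y) ≡ Y
drop-++ []      Y = refl
drop-++ (x ∷ X) Y = drop-++ X Y

∣take∣+∣drop∣ : ∀ m {k} (X : Subset (m + k)) → ∣ Vec.take m X ∣ + ∣ Vec.drop m X ∣ ≡ ∣ X ∣
∣take∣+∣drop∣ zero    X             = refl
∣take∣+∣drop∣ (suc m) (inside  ∷ X) = cong suc (∣take∣+∣drop∣ m X)
∣take∣+∣drop∣ (suc m) (outside ∷ X) = ∣take∣+∣drop∣ m X

addLoops : ∀ k → Matroid m → Matroid (m + k)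
addLoops {m} k N = record
  { rank            = λ X → rank N (Vec.take m X)
  ; rank-≤-size     = λ X → ≤-trans (Matroid.rank-≤-size N _) (m+n≤o⇒m≤o _ (≤-reflexive (∣take∣+∣drop∣ m X)))
  ; rank-mono       = λ X⊆Y → Matroid.rank-mono N (take-⊆ m X⊆Y)
  ; rank-submodular = submodular
  }
  where
  submodular : ∀ X Y → rank N (Vec.take m (X ∪ Y)) + rank N (Vec.take m (X ∩ Y))
                     ≤ rank N (Vec.take m X) + rank N (Vec.take m Y)
  submodular X Y rewrite take-zipWith {m = m} _∨_ X Y | take-zipWith {m = m} _∧_ X Y =
    Matroid.rank-submodular N _ _

addColoops : ∀ k → Matroid m → Matroid (m + k)
addColoops {m} k M = record
  { rank            = λ X → rank M (Vec.take m X) + ∣ Vec.drop m X ∣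
  ; rank-≤-size     = λ X → ≤-trans (+-monoˡ-≤ _ (Matroid.rank-≤-size M _)) (≤-reflexive (∣take∣+∣drop∣ m X))
  ; rank-mono       = λ X⊆Y → +-mono-≤ (Matroid.rank-mono M (take-⊆ m X⊆Y)) (p⊆q⇒∣p∣≤∣q∣ (drop-⊆ m X⊆Y))
  ; rank-submodular = submodular
  }
  where
  open CommutativeSemigroupₚ +-commutativeSemigroup using (interchange)
  submodular : ∀ X Y → (rank M (Vec.take m (X ∪ Y)) + ∣ Vec.drop m (X ∪ Y) ∣)
                       + (rank M (Vec.take m (X ∩ Y)) + ∣ Vec.drop m (X ∩ Y) ∣)
                     ≤ (rank M (Vec.take m X) + ∣ Vec.drop m X ∣) + (rank M (Vec.take m Y) + ∣ Vec.drop m Y ∣)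
  submodular X Y
    rewrite take-zipWith {m = m} _∨_ X Y | take-zipWith {m = m} _∧_ X Y
          | drop-zipWith {m = m} _∨_ X Y | drop-zipWith {m = m} _∧_ X Y
    = split (Vec.take m X) (Vec.take m Y) (Vec.drop m X) (Vec.drop m Y)
    where
    open ≤-Reasoning
    split : ∀ X Y Z W → (rank M (X ∪ Y) + ∣ Z ∪ W ∣) + (rank M (X ∩ Y) + ∣ Z ∩ W ∣)
                      ≤ (rank M X + ∣ Z ∣) + (rank M Y + ∣ W ∣)
    split X Y Z W = begin
      (rank M (X ∪ Y) + ∣ Z ∪ W ∣) + (rank M (X ∩ Y) + ∣ Z ∩ W ∣)  ≡⟨ interchange (rank M (X ∪ Y)) _ _ _ ⟩
      (rank M (X ∪ Y) + rank M (X ∩ Y)) + (∣ Z ∪ W ∣ + ∣ Z ∩ W ∣)  ≤⟨ +-mono-≤ (Matroid.rank-submodular M X Y) (≤-reflexive (∣∪∣+∣∩∣ Z W)) ⟩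
      (rank M X + rank M Y) + (∣ Z ∣ + ∣ W ∣)                      ≡⟨ interchange (rank M X) _ _ _ ⟩
      (rank M X + ∣ Z ∣) + (rank M Y + ∣ W ∣)                      ∎

quotient-extend : ∀ k {N M : Matroid m} → IsQuotient N M → IsQuotient (addLoops k N) (addColoops k M)
quotient-extend {m} k {N} {M} quo {X} {Y} X⊆Y = begin
  nY + (mX + dX)  ≡⟨ +-assoc nY mX dX ⟨
  nY + mX + dX    ≤⟨ +-mono-≤ (quo (take-⊆ m X⊆Y)) (p⊆q⇒∣p∣≤∣q∣ (drop-⊆ m X⊆Y)) ⟩
  mY + nX + dY    ≡⟨ +-assoc mY nX dY ⟩
  mY + (nX + dY)  ≡⟨ cong (λ r → mY + r) (+-comm nX dY) ⟩
  mY + (dY + nX)  ≡⟨ +-assoc mY dY nX ⟨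
  mY + dY + nX    ∎
  where
  open ≤-Reasoning
  nX = rank N (Vec.take m X)
  nY = rank N (Vec.take m Y)
  mX = rank M (Vec.take m X)
  mY = rank M (Vec.take m Y)
  dX = ∣ Vec.drop m X ∣
  dY = ∣ Vec.drop m Y ∣

-- With i loops added to N and i coloops to M, deleting the new elements from
-- the Higgs lift gives back the Higgs lift, and contracting them gives N.
higgs-isLift : {N M : Matroid m} (quo : IsQuotient N M) → ∀ i → IsLift (higgs N M quo i) N
higgs-isLift {m} {N} {M} quo i = i , P , deletion , contraction
  where
  P : Matroid (m + i)
  P = higgs (addLoops i N) (addColoops i M) (quotient-extend i {N} {M} quo) i

  rank-P : ∀ X Z → rank P (X Vec.++ Z) ≡ (rank N X + i) ⊓ (rank M X + ∣ Z ∣)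
  rank-P X Z rewrite take-++ X Z | drop-++ X Z = refl

  -- Once all `i` new elements are present, both terms of the minimum carry the same `+ i`, and the
  -- term of `N` is the smaller by `quotient-rank-≤`.
  rank-P-⊤ : ∀ X → rank P (X Vec.++ Subset.⊤) ≡ rank N X + i
  rank-P-⊤ X = begin
    rank P (X Vec.++ Subset.⊤)                          ≡⟨ rank-P X Subset.⊤ ⟩
    (rank N X + i) ⊓ (rank M X + ∣ Subset.⊤ {i} ∣)      ≡⟨ cong (λ z → (rank N X + i) ⊓ (rank M X + z)) (Subsetₚ.∣⊤∣≡n i) ⟩
    (rank N X + i) ⊓ (rank M X + i)                     ≡⟨ m≤n⇒m⊓n≡m (+-monoˡ-≤ i (quotient-rank-≤ {N = N} {M} quo X)) ⟩
    rank N X + i                                        ∎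
    where open ≡-Reasoning

  deletion : IsDeletion i P (higgs N M quo i)
  deletion Y = sym (trans (rank-P Y Subset.⊥)
    (cong ((rank N Y + i) ⊓_) (trans (cong (λ r → rank M Y + r) (∣⊥∣≡0 i)) (+-identityʳ _))))

  contraction : IsContraction i P N
  contraction Y = sym (begin
    rank P (Y Vec.++ Subset.⊤) ∸ rank P (Subset.⊥ {m} Vec.++ Subset.⊤)  ≡⟨ cong₂ _∸_ (rank-P-⊤ Y) (rank-P-⊤ Subset.⊥) ⟩
    (rank N Y + i) ∸ (rank N (Subset.⊥ {m}) + i)                        ≡⟨ cong (λ z → (rank N Y + i) ∸ (z + i)) rank-⊥ ⟩
    (rank N Y + i) ∸ i                                                  ≡⟨ m+n∸n≡m (rank N Y) i ⟩
    rank N Y                                                            ∎)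
    where
    open ≡-Reasoning
    rank-⊥ : rank N (Subset.⊥ {m}) ≡ 0
    rank-⊥ = n≤0⇒n≡0 (≤-trans (Matroid.rank-≤-size N Subset.⊥) (≤-reflexive (∣⊥∣≡0 m)))

-- The matroid of a gain graph

open import Data.Integer using (ℤ; +_; 0ℤ; 1ℤ)
  renaming (_+_ to _+ℤ_; _*_ to _*ℤ_; _-_ to _-ℤ_; -_ to -ℤ_; ∣_∣ to abs)
open import Data.Integer.DivMod using (_%ℕ_; _/ℕ_; n%ℕd<d; a≡a%ℕn+[a/ℕn]*n)
open import Data.Integer.Divisibility.Signed
  using (_∣_; divides; _∣?_; ∣ᵤ⇒∣; ∣⇒∣ᵤ; ∣m⇒∣-m; ∣m∣n⇒∣m+n; ∣m+n∣n⇒∣m; ∣n⇒∣m*n; ∣m⇒∣m*n)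
import Data.Integer.Properties as ℤₚ
import Data.Integer.Solver as ℤ-Solver

allVec? : ∀ {p} j {P : Vec (Fin p) j → Set} → (∀ v → Dec (P v)) → Dec (∀ v → P v)
allVec? zero    P? = map′ (λ { P[] [] → P[] }) (λ ∀P → ∀P []) (P? [])
allVec? (suc j) P? = map′ (λ { ∀P (x ∷ v) → ∀P x v }) (λ ∀P x v → ∀P (x ∷ v))
                          (Finₚ.all? λ x → allVec? j λ v → P? (x ∷ v))

module Gains {p : ℕ} (p-prime : Prime p) where
  open ℤ-Solver.+-*-Solver using (solve; _:+_; _:*_; _:-_; :-_; _:=_; con)

  private instance _ = prime⇒nonZero p-prime

  -- Congruence modulo p

  infix 4 _≈_
  -- Wrapped in a record so that `a` and `b` can be inferred: the integer `a -ℤ b` alone does not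
  -- determine them.
  record _≈_ (a b : ℤ) : Set where
    constructor mk≈
    field difference : + p ∣ a -ℤ b

  open _≈_

  ≈-refl : ∀ {a} → a ≈ a
  ≈-refl {a} = mk≈ (divides 0ℤ (ℤₚ.+-inverseʳ a))

  ≈-sym : ∀ {a b} → a ≈ b → b ≈ a
  ≈-sym {a} {b} (mk≈ d) = mk≈ (subst (+ p ∣_) (solve 2 (λ a b → :- (a :- b) := b :- a) refl a b) (∣m⇒∣-m d))

  ≈-trans : ∀ {a b c} → a ≈ b → b ≈ c → a ≈ c
  ≈-trans {a} {b} {c} (mk≈ d) (mk≈ d′) = mk≈ (subst (+ p ∣_)
    (solve 3 (λ a b c → (a :- b) :+ (b :- c) := a :- c) refl a b c) (∣m∣n⇒∣m+n d d′))

  ≈-reflexive : ∀ {a b} → a ≡ b → a ≈ b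
  ≈-reflexive refl = ≈-refl

  +-≈ : ∀ {a b c d} → a ≈ b → c ≈ d → a +ℤ c ≈ b +ℤ d
  +-≈ {a} {b} {c} {d} (mk≈ x) (mk≈ y) = mk≈ (subst (+ p ∣_)
    (solve 4 (λ a b c d → (a :- b) :+ (c :- d) := (a :+ c) :- (b :+ d)) refl a b c d) (∣m∣n⇒∣m+n x y))

  +-≈ˡ : ∀ c {a b} → a ≈ b → c +ℤ a ≈ c +ℤ b
  +-≈ˡ c = +-≈ (≈-refl {c})

  +-≈ʳ : ∀ c {a b} → a ≈ b → a +ℤ c ≈ b +ℤ c
  +-≈ʳ c a≈b = +-≈ a≈b (≈-refl {c})

  neg-≈ : ∀ {a b} → a ≈ b → -ℤ a ≈ -ℤ b
  neg-≈ {a} {b} (mk≈ d) = mk≈ (subst (+ p ∣_)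
    (solve 2 (λ a b → :- (a :- b) := (:- a) :- (:- b)) refl a b) (∣m⇒∣-m d))

  *-≈ˡ : ∀ c {a b} → a ≈ b → c *ℤ a ≈ c *ℤ b
  *-≈ˡ c {a} {b} (mk≈ d) = mk≈ (subst (+ p ∣_)
    (solve 3 (λ a b c → c :* (a :- b) := c :* a :- c :* b) refl a b c) (∣n⇒∣m*n c d))

  *-≈ʳ : ∀ c {a b} → a ≈ b → a *ℤ c ≈ b *ℤ c
  *-≈ʳ c {a} {b} (mk≈ d) = mk≈ (subst (+ p ∣_)
    (solve 3 (λ a b c → (a :- b) :* c := a :* c :- b :* c) refl a b c) (∣m⇒∣m*n c d))

  ≈0⇒∣ : ∀ {a} → a ≈ 0ℤ → + p ∣ a
  ≈0⇒∣ {a} (mk≈ d) = subst (+ p ∣_) (ℤₚ.+-identityʳ a) d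

  ∣⇒≈0 : ∀ {a} → + p ∣ a → a ≈ 0ℤ
  ∣⇒≈0 {a} d = mk≈ (subst (+ p ∣_) (sym (ℤₚ.+-identityʳ a)) d)

  ∣-resp-≈ : ∀ {a b} → a ≈ b → + p ∣ a → + p ∣ b
  ∣-resp-≈ a≈b p∣a = ≈0⇒∣ (≈-trans (≈-sym a≈b) (∣⇒≈0 p∣a))

  -- Stands in for division by a nonzero scalar in `span-exchange`.
  ∣-* : ∀ a b → + p ∣ a *ℤ b → (+ p ∣ a) ⊎ (+ p ∣ b)
  ∣-* a b p∣ab = Sum.map ∣ᵤ⇒∣ ∣ᵤ⇒∣
    (euclidsLemma (abs a) (abs b) p-prime (subst (p ℕ∣.∣_) (ℤₚ.abs-* a b) (∣⇒∣ᵤ p∣ab)))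

  residue : ℤ → Fin p
  residue a = fromℕ< (n%ℕd<d a p)

  residue-≈ : ∀ a → + toℕ (residue a) ≈ a
  residue-≈ a = ≈-sym (mk≈ (divides (a /ℕ p) (begin
    a -ℤ + toℕ (residue a)                                       ≡⟨ cong₂ _-ℤ_ (a≡a%ℕn+[a/ℕn]*n a p) (cong +_ (toℕ-fromℕ< (n%ℕd<d a p))) ⟩
    + (a %ℕ p) +ℤ (a /ℕ p) *ℤ + p -ℤ + (a %ℕ p)                  ≡⟨ solve 2 (λ r q → r :+ q :- r := q) refl (+ (a %ℕ p)) ((a /ℕ p) *ℤ + p) ⟩
    (a /ℕ p) *ℤ + p                                              ∎)))
    where open ≡-Reasoning

  dot : ∀ {j} → (Fin j → ℤ) → Vec (Fin p) j → ℤ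
  dot g []      = 0ℤ
  dot g (x ∷ v) = g zero *ℤ + toℕ x +ℤ dot (λ k → g (suc k)) v

  dot-cong : ∀ {j} {g g′ : Fin j → ℤ} → (∀ k → g k ≈ g′ k) → ∀ v → dot g v ≈ dot g′ v
  dot-cong g≈g′ []      = ≈-refl
  dot-cong g≈g′ (x ∷ v) = +-≈ (*-≈ʳ (+ toℕ x) (g≈g′ zero)) (dot-cong (λ k → g≈g′ (suc k)) v)

  dot-linear : ∀ {j} a b (g g′ : Fin j → ℤ) v →
               dot (λ k → a *ℤ g k +ℤ b *ℤ g′ k) v ≡ a *ℤ dot g v +ℤ b *ℤ dot g′ v
  dot-linear a b g g′ []      = solve 2 (λ a b → con 0ℤ := a :* con 0ℤ :+ b :* con 0ℤ) refl a b
  dot-linear a b g g′ (x ∷ v) rewrite dot-linear a b (λ k → g (suc k)) (λ k → g′ (suc k)) v =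
    solve 7 (λ a b y z x s t → (a :* y :+ b :* z) :* x :+ (a :* s :+ b :* t)
                               := a :* (y :* x :+ s) :+ b :* (z :* x :+ t))
      refl a b (g zero) (g′ zero) (+ toℕ x) _ _

  module _ {n m j : ℕ} (G : Multigraph n m) (φ : Fin m → Vec (Fin p) j) where
    open Multigraph G

    -- The pair (h , g) is a linear functional on 𝔽ₚⁿ ⊕ 𝔽ₚʲ, and the edge e
    -- stands for the vector (χ_target − χ_source , φ e).
    value : (Fin n → ℤ) → (Fin j → ℤ) → Fin m → ℤ
    value h g e = h (target e) -ℤ h (source e) +ℤ dot g (φ e)

    Vanishes : (Fin n → ℤ) → (Fin j → ℤ) → Fin m → Set
    Vanishes h g e = + p ∣ value h g e

    _∈Span_ : Fin m → List (Fin m) → Set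
    e ∈Span l = ∀ h g → All (Vanishes h g) l → Vanishes h g e

    value-cong : ∀ {h h′ g g′} → (∀ x → h x ≈ h′ x) → (∀ k → g k ≈ g′ k) → ∀ e → value h g e ≈ value h′ g′ e
    value-cong h≈h′ g≈g′ e = +-≈ (+-≈ (h≈h′ _) (neg-≈ (h≈h′ _))) (dot-cong g≈g′ (φ e))

    value-linear : ∀ a b h h′ g g′ e →
      value (λ x → a *ℤ h x +ℤ b *ℤ h′ x) (λ k → a *ℤ g k +ℤ b *ℤ g′ k) e ≡ a *ℤ value h g e +ℤ b *ℤ value h′ g′ e
    value-linear a b h h′ g g′ e rewrite dot-linear a b g g′ (φ e) =
      solve 8 (λ a b t s u v y z → (a :* t :+ b :* u) :- (a :* s :+ b :* v) :+ (a :* y :+ b :* z)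
                                   := a :* (t :- s :+ y) :+ b :* (u :- v :+ z))
        refl a b (h (target e)) (h (source e)) (h′ (target e)) (h′ (source e)) (dot g (φ e)) (dot g′ (φ e))

    span? : ∀ l e → Dec (e ∈Span l)
    span? l e = map′ to from (allVec? n λ u → allVec? j λ v →
      All.all? (λ f → + p ∣? value (lift u) (lift v) f) l →-dec (+ p ∣? value (lift u) (lift v) e))
      where
      lift : ∀ {k} → Vec (Fin p) k → Fin k → ℤ
      lift v k = + toℕ (lookup v k)
      residues : ∀ {k} → (Fin k → ℤ) → Vec (Fin p) k
      residues h = tabulate (λ x → residue (h x))
      lift-residues : ∀ {k} (h : Fin k → ℤ) x → lift (residues h) x ≈ h x
      lift-residues h x = subst (λ r → + toℕ r ≈ h x) (sym (lookup∘tabulate _ x)) (residue-≈ (h x))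
      Reduced : Set
      Reduced = ∀ u v → All (Vanishes (lift u) (lift v)) l → Vanishes (lift u) (lift v) e
      to : Reduced → e ∈Span l
      to red h g l0 = ∣-resp-≈ (reduce e) (red (residues h) (residues g)
        (All.map (λ {f} → ∣-resp-≈ (≈-sym (reduce f))) l0))
        where
        reduce : ∀ f → value (lift (residues h)) (lift (residues g)) f ≈ value h g f
        reduce = value-cong (lift-residues h) (lift-residues g)
      from : e ∈Span l → Reduced
      from e∈ u v = e∈ (lift u) (lift v)

    -- If h vanishes on a ∷ l and not on b, then h′(b) h − h(b) h′ vanishes on
    -- b ∷ l for every h′ vanishing on l; so it vanishes on a, and so does h′.
    span-exchange : ∀ {l a b} → a ∈Span (b ∷ l) → ¬ a ∈Span l → b ∈Span (a ∷ l)
    span-exchange {l} {a} {b} a∈bl a∉l h g (ha ∷ hl) = decidable-stable (+ p ∣? value h g b) λ hb≉0 →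
      a∉l λ h′ g′ hl′ →
        let x = value h g b
            y = value h′ g′ b
            h″ = λ v → x *ℤ h′ v +ℤ (-ℤ y) *ℤ h v
            g″ = λ v → x *ℤ g′ v +ℤ (-ℤ y) *ℤ g v
            on-b : Vanishes h″ g″ b
            on-b = subst (+ p ∣_) (trans (solve 2 (λ x y → con 0ℤ := x :* y :+ (:- y) :* x) refl x y)
                                         (sym (value-linear x (-ℤ y) h′ h g′ g b))) (divides 0ℤ refl)
            on-l : All (Vanishes h″ g″) l
            on-l = All.zipWith (λ {f} (hf′ , hf) → subst (+ p ∣_) (sym (value-linear x (-ℤ y) h′ h g′ g f))
                     (∣m∣n⇒∣m+n (∣n⇒∣m*n x hf′) (∣n⇒∣m*n (-ℤ y) hf))) (hl′ , hl)
            on-a : + p ∣ x *ℤ value h′ g′ a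
            on-a = ∣m+n∣n⇒∣m (subst (+ p ∣_) (value-linear x (-ℤ y) h′ h g′ g a) (a∈bl h″ g″ (on-b ∷ on-l)))
                             (∣n⇒∣m*n (-ℤ y) ha)
        in Sum.[ (λ hb≈0 → contradiction hb≈0 hb≉0) , (λ z → z) ] (∣-* x _ on-a)

    gainClosure : ClosureSpace (Fin m)
    gainClosure = record
      { _⊢_      = λ l e → e ∈Span l
      ; _⊢?_     = span?
      ; ∈⇒⊢      = λ a∈l h g hl → All.lookup hl a∈l
      ; cut      = λ k⊢l l⊢a h g hk → l⊢a h g (All.map (λ k⊢b → k⊢b h g hk) k⊢l)
      ; exchange = span-exchange
      }

-- Walks, cycles and gains

module _ {n m : ℕ} {G : Multigraph n m} where
  open Multigraph G

  start∈ : ∀ {u w} (W : Walk G u w) → u ∈ vertices W ⊎ u ≡ w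
  start∈ stop            = inj₂ refl
  start∈ (step _ _ _ _)  = inj₁ (here refl)

  private
    ends≢ : ∀ d e {x} → initial G d e ≢ x → terminal G d e ≢ x → source e ≢ x × target e ≢ x
    ends≢ forward  e i≢ t≢ = i≢ , t≢
    ends≢ backward e i≢ t≢ = t≢ , i≢

  edges-avoid : ∀ {u w x} (W : Walk G u w) → ¬ x ∈ vertices W → x ≢ w →
                All (λ f → source f ≢ x × target f ≢ x) (edges W)
  edges-avoid stop _ _ = []
  edges-avoid {x = x} (step d e refl W) x∉ x≢w =
    ends≢ d e (λ eq → x∉ (here (sym eq))) t≢ ∷ edges-avoid W (x∉ ∘ there) x≢w
    where
    t≢ : terminal G d e ≢ x
    t≢ refl = [ x∉ ∘ there , x≢w ] (start∈ W)

  ∈-edgeSet⁺ : ∀ {u w e} (W : Walk G u w) → e ∈ edges W → e Subset.∈ edgeSet W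
  ∈-edgeSet⁺ (step _ e _ W) (here refl) = x∈p∪q⁺ (inj₁ (x∈⁅x⁆ e))
  ∈-edgeSet⁺ (step _ e _ W) (there e∈)  = x∈p∪q⁺ (inj₂ (∈-edgeSet⁺ W e∈))

  ∈-edgeSet⁻ : ∀ {u w e} (W : Walk G u w) → e Subset.∈ edgeSet W → e ∈ edges W
  ∈-edgeSet⁻ stop           e∈ = contradiction e∈ Subsetₚ.∉⊥
  ∈-edgeSet⁻ (step _ f _ W) e∈ =
    [ here ∘ x∈⁅y⁆⇒x≡y f , there ∘ ∈-edgeSet⁻ W ] (x∈p∪q⁻ ⁅ f ⁆ (edgeSet W) e∈)

  ∣edgeSet∣≤length : ∀ {u w} (W : Walk G u w) → ∣ edgeSet W ∣ ≤ length (edges W)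
  ∣edgeSet∣≤length stop           = ≤-reflexive (∣⊥∣≡0 m)
  ∣edgeSet∣≤length (step _ e _ W) = begin
    ∣ ⁅ e ⁆ ∪ edgeSet W ∣                              ≤⟨ m≤m+n _ _ ⟩
    ∣ ⁅ e ⁆ ∪ edgeSet W ∣ + ∣ ⁅ e ⁆ ∩ edgeSet W ∣      ≡⟨ ∣∪∣+∣∩∣ ⁅ e ⁆ (edgeSet W) ⟩
    ∣ ⁅ e ⁆ ∣ + ∣ edgeSet W ∣                          ≤⟨ +-mono-≤ (≤-reflexive (Subsetₚ.∣⁅x⁆∣≡1 e)) (∣edgeSet∣≤length W) ⟩
    suc (length (edges W))                             ∎
    where open ≤-Reasoning

  -- `vertices` leaves out the final vertex, so its distinctness from the others is a separate
  -- condition.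
  IsPath : ∀ {u w} → Walk G u w → Set
  IsPath {w = w} W = Unique (vertices W) × ¬ w ∈ vertices W

  path-tail : ∀ {w} d e (W : Walk G (terminal G d e) w) → IsPath (step d e refl W) → IsPath W
  path-tail d e W (_ ∷ vs! , w∉) = vs! , w∉ ∘ there

  path-tail-avoids : ∀ {w} d e (W : Walk G (terminal G d e) w) → IsPath (step d e refl W) →
    terminal G d e ≢ initial G d e × All (λ f → source f ≢ initial G d e × target f ≢ initial G d e) (edges W)
  path-tail-avoids d e W (u∉ ∷ _ , w∉) = t≢ , edges-avoid W (λ u∈ → All.lookup u∉ u∈ refl) (λ u≡w → w∉ (here (sym u≡w)))
    where
    t≢ : terminal G d e ≢ initial G d e
    t≢ t≡u = [ (λ t∈ → All.lookup u∉ t∈ (sym t≡u)) , (λ t≡w → w∉ (here (trans (sym t≡w) t≡u))) ] (start∈ W)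

  closed-tail-path : ∀ {u} d e (W : Walk G (terminal G d e) u) (u≡ : initial G d e ≡ u) →
    Unique (vertices (step {G = G} d e u≡ W)) → IsPath W
  closed-tail-path d e W u≡ (u∉ ∷ vs!) = vs! , λ u∈ → All.lookup u∉ u∈ refl

-- Submodularity gives `rank M X ≤ rank M D + ∣ X ─ D ∣`, so a deficit in `D` would persist in `X`.
independent-⊆ : ∀ {m} (M : Matroid m) {D X} → D Subset.⊆ X → ∣ X ∣ ≤ rank M X → ∣ D ∣ ≤ rank M D
independent-⊆ M {D} {X} D⊆X ∣X∣≤r = +-cancelʳ-≤ ∣ X ─ D ∣ _ _ (begin
  ∣ D ∣ + ∣ X ─ D ∣                            ≡⟨ ∣∣-split D X D⊆X ⟩
  ∣ X ∣                                        ≤⟨ ∣X∣≤r ⟩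
  rank M X                                     ≤⟨ Matroid.rank-mono M X⊆ ⟩
  rank M (D ∪ (X ─ D))                         ≤⟨ m≤m+n _ _ ⟩
  rank M (D ∪ (X ─ D)) + rank M (D ∩ (X ─ D))  ≤⟨ Matroid.rank-submodular M D _ ⟩
  rank M D + rank M (X ─ D)                    ≤⟨ +-monoʳ-≤ (rank M D) (Matroid.rank-≤-size M _) ⟩
  rank M D + ∣ X ─ D ∣                         ∎)
  where
  open ≤-Reasoning
  ∣∣-split : ∀ {m} (D X : Subset m) → D Subset.⊆ X → ∣ D ∣ + ∣ X ─ D ∣ ≡ ∣ X ∣
  ∣∣-split [] [] _ = refl
  ∣∣-split (inside ∷ D) (inside ∷ X) D⊆X = cong suc (∣∣-split D X (drop-∷-⊆ D⊆X))
  ∣∣-split (inside ∷ D) (outside ∷ X) D⊆X with () ← D⊆X here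
  ∣∣-split (outside ∷ D) (inside ∷ X) D⊆X = trans (+-suc _ _) (cong suc (∣∣-split D X (drop-∷-⊆ D⊆X)))
  ∣∣-split (outside ∷ D) (outside ∷ X) D⊆X = ∣∣-split D X (drop-∷-⊆ D⊆X)
  X⊆ : X Subset.⊆ D ∪ (X ─ D)
  X⊆ {x} x∈X with x Subsetₚ.∈? D
  ... | yes x∈D = x∈p∪q⁺ (inj₁ x∈D)
  ... | no  x∉D = x∈p∪q⁺ (inj₂ (Subsetₚ.x∈p∧x∉q⇒x∈p─q x∈X x∉D))

module GainWalks {p : ℕ} (p-prime : Prime p) where
  open Gains p-prime
  open ℤ-Solver.+-*-Solver using (solve; _:+_; _:*_; _:-_; :-_; _:=_; con)

  private instance _ = prime⇒nonZero p-prime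

  1≉0 : ¬ + p ∣ 1ℤ
  1≉0 p∣1 with refl ← ℕ∣.∣1⇒≡1 (∣⇒∣ᵤ p∣1) = ¬prime[1] p-prime

  mod-≈ : ∀ a → + toℕ (mod p a) ≈ + a
  mod-≈ a = residue-≈ (+ a)

  ∣toℕ⇒≡0ₚ : ∀ (x : Fin p) → + p ∣ + toℕ x → x ≡ 0ₚ p
  ∣toℕ⇒≡0ₚ x p∣x with toℕ x in eq
  ... | zero  = toℕ-injective (trans eq (sym (trans (toℕ-mod p 0) (m<n⇒m%n≡m (≤-<-trans z≤n (toℕ<n x))))))
  ... | suc k = contradiction (ℕ∣.∣⇒≤ (∣⇒∣ᵤ p∣x)) (<⇒≱ (subst (_< p) eq (toℕ<n x)))

  dot-+ : ∀ {j} (g : Fin j → ℤ) v w → dot g (zipWith (_+ₚ_ p) v w) ≈ dot g v +ℤ dot g w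
  dot-+ g []      []      = ≈-refl
  dot-+ g (x ∷ v) (y ∷ w) = ≈-trans (+-≈ (*-≈ˡ (g zero) (mod-≈ (toℕ x + toℕ y))) (dot-+ (g ∘ suc) v w))
    (≈-reflexive (trans (cong (λ s → g zero *ℤ s +ℤ (dot (g ∘ suc) v +ℤ dot (g ∘ suc) w)) (ℤₚ.pos-+ (toℕ x) (toℕ y)))
      (solve 5 (λ g x y s t → g :* (x :+ y) :+ (s :+ t) := (g :* x :+ s) :+ (g :* y :+ t)) refl
        (g zero) (+ toℕ x) (+ toℕ y) (dot (g ∘ suc) v) (dot (g ∘ suc) w))))

  dot-0 : ∀ {j} (g : Fin j → ℤ) → dot g (replicate j (0ₚ p)) ≈ 0ℤ
  dot-0 {zero}  g = ≈-refl
  dot-0 {suc j} g = ≈-trans (+-≈ (*-≈ˡ (g zero) (mod-≈ 0)) (dot-0 (g ∘ suc)))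
    (≈-reflexive (solve 1 (λ x → x :* con 0ℤ :+ con 0ℤ := con 0ℤ) refl (g zero)))

  dot-neg : ∀ {j} (g : Fin j → ℤ) v → dot g (Vec.map (-ₚ_ p) v) ≈ -ℤ dot g v
  dot-neg g []      = ≈-refl
  dot-neg g (x ∷ v) = ≈-trans (+-≈ (*-≈ˡ (g zero) -x≈) (dot-neg (g ∘ suc) v))
    (≈-reflexive (solve 3 (λ g x s → g :* (:- x) :+ (:- s) := :- (g :* x :+ s)) refl (g zero) (+ toℕ x) (dot (g ∘ suc) v)))
    where
    -x≈ : + toℕ (-ₚ_ p x) ≈ -ℤ (+ toℕ x)
    -x≈ = ≈-trans (mod-≈ (p ∸ toℕ x)) (mk≈ (divides 1ℤ (begin
      + (p ∸ toℕ x) -ℤ (-ℤ (+ toℕ x))  ≡⟨ cong (+ (p ∸ toℕ x) +ℤ_) (ℤₚ.neg-involutive (+ toℕ x)) ⟩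
      + (p ∸ toℕ x) +ℤ + toℕ x         ≡⟨ ℤₚ.pos-+ (p ∸ toℕ x) (toℕ x) ⟨
      + (p ∸ toℕ x + toℕ x)            ≡⟨ cong +_ (m∸n+n≡m (<⇒≤ (toℕ<n x))) ⟩
      + p                              ≡⟨ ℤₚ.*-identityˡ (+ p) ⟨
      1ℤ *ℤ + p                        ∎)))
      where open ≡-Reasoning

  δ : ∀ {j} → Fin j → Fin j → ℤ
  δ zero    zero    = 1ℤ
  δ zero    (suc _) = 0ℤ
  δ (suc _) zero    = 0ℤ
  δ (suc k) (suc l) = δ k l

  dot-zeroˡ : ∀ {j} (v : Vec (Fin p) j) → dot (λ _ → 0ℤ) v ≡ 0ℤ
  dot-zeroˡ []      = refl
  dot-zeroˡ (x ∷ v) rewrite dot-zeroˡ v = refl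

  dot-δ : ∀ {j} (k : Fin j) v → dot (δ k) v ≡ + toℕ (lookup v k)
  dot-δ zero    (x ∷ v) rewrite dot-zeroˡ v = trans (ℤₚ.+-identityʳ _) (ℤₚ.*-identityˡ _)
  dot-δ (suc k) (x ∷ v) rewrite dot-δ k v = ℤₚ.+-identityˡ _

  module _ {n m j : ℕ} {G : Multigraph n m} {φ : Fin m → Vec (Fin p) j} where
    open Multigraph G

    private
      Γ = ℤₚ^ p j
      𝓜 = gainClosure G φ
      open ClosureSpace 𝓜

    gain : Direction → Fin m → Vec (Fin p) j
    gain forward  e = φ e
    gain backward e = Vec.map (-ₚ_ p) (φ e)

    ascent : (h : Fin n → ℤ) (g : Fin j → ℤ) → Direction → Fin m → ℤ
    ascent h g d e = h (terminal G d e) -ℤ h (initial G d e) +ℤ dot g (gain d e)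

    private
      ascent-backward : ∀ h g e → ascent h g backward e ≈ -ℤ value G φ h g e
      ascent-backward h g e = ≈-trans (+-≈ˡ (h (source e) -ℤ h (target e)) (dot-neg g (φ e)))
        (≈-reflexive (solve 3 (λ s t y → s :- t :+ (:- y) := :- (t :- s :+ y)) refl (h (source e)) (h (target e)) (dot g (φ e))))

    vanishes⇒ascent≈0 : ∀ h g d e → Vanishes G φ h g e → ascent h g d e ≈ 0ℤ
    vanishes⇒ascent≈0 h g forward e he = ∣⇒≈0 he
    vanishes⇒ascent≈0 h g backward e he = ≈-trans (ascent-backward h g e) (neg-≈ (∣⇒≈0 he))

    ascent≈0⇒vanishes : ∀ h g d e → ascent h g d e ≈ 0ℤ → Vanishes G φ h g e
    ascent≈0⇒vanishes h g forward e a≈0 = ≈0⇒∣ a≈0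
    ascent≈0⇒vanishes h g backward e a≈0 = ≈0⇒∣ (subst (_≈ 0ℤ) (ℤₚ.neg-involutive _)
      (neg-≈ (≈-trans (≈-sym (ascent-backward h g e)) a≈0)))

    -- The telescoped form: potential differences along the walk collapse to its two ends.
    -- `walkAscent-step` recovers the sum over the edges, modulo `p`.
    walkAscent : ∀ {u w} → (Fin n → ℤ) → (Fin j → ℤ) → Walk G u w → ℤ
    walkAscent {u} {w} h g W = h w -ℤ h u +ℤ dot g (walkLabel Γ φ W)

    walkAscent-stop : ∀ {u} h g → walkAscent {u} h g stop ≈ 0ℤ
    walkAscent-stop {u} h g = +-≈ (≈-reflexive (ℤₚ.+-inverseʳ (h u))) (dot-0 g)

    walkAscent-step : ∀ {w} h g d e (W : Walk G (terminal G d e) w) →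
      walkAscent h g (step d e refl W) ≈ ascent h g d e +ℤ walkAscent h g W
    walkAscent-step {w} h g d e W = ≈-trans (+-≈ˡ (h w -ℤ h (initial G d e)) (label-step d))
      (≈-reflexive (solve 5 (λ w u t y z → w :- u :+ (y :+ z) := (t :- u :+ y) :+ (w :- t :+ z)) refl
        (h w) (h (initial G d e)) (h (terminal G d e)) (dot g (gain d e)) (dot g (walkLabel Γ φ W))))
      where
      label-step : ∀ d {u} {W : Walk G (terminal G d e) u} →
        dot g (walkLabel Γ φ (step d e refl W)) ≈ dot g (gain d e) +ℤ dot g (walkLabel Γ φ W)
      label-step forward  {W = W} = dot-+ g (φ e) (walkLabel Γ φ W)
      label-step backward {W = W} = dot-+ g (Vec.map (-ₚ_ p) (φ e)) (walkLabel Γ φ W)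

    walkAscent≈0 : ∀ {u w} h g (W : Walk G u w) → All (Vanishes G φ h g) (edges W) → walkAscent h g W ≈ 0ℤ
    walkAscent≈0 h g stop [] = walkAscent-stop h g
    walkAscent≈0 h g (step d e refl W) (he ∷ hW) =
      ≈-trans (walkAscent-step h g d e W) (+-≈ (vanishes⇒ascent≈0 h g d e he) (walkAscent≈0 h g W hW))

    -- The values along a closed walk of trivial gain add up to zero, so one of
    -- them vanishes when all the others do.
    vanishes-on-last : ∀ {u w e} h g (W : Walk G u w) → Unique (edges W) → e ∈ edges W →
      (∀ {f} → f ∈ edges W → f ≢ e → Vanishes G φ h g f) → walkAscent h g W ≈ 0ℤ → Vanishes G φ h g e
    vanishes-on-last h g (step d e refl W) (e∉ ∷ _) (here refl) others total =
      ascent≈0⇒vanishes h g d e (≈-trans (≈-sym drop-rest) total)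
      where
      rest≈0 : walkAscent h g W ≈ 0ℤ
      rest≈0 = walkAscent≈0 h g W (All.tabulate λ f∈ → others (there f∈) (λ f≡e → All.lookup e∉ f∈ (sym f≡e)))
      drop-rest : walkAscent h g (step d e refl W) ≈ ascent h g d e
      drop-rest = ≈-trans (walkAscent-step h g d e W)
        (≈-trans (+-≈ˡ (ascent h g d e) rest≈0) (≈-reflexive (ℤₚ.+-identityʳ _)))
    vanishes-on-last h g (step d f refl W) (f∉ ∷ W!) (there e∈) others total =
      vanishes-on-last h g W W! e∈ (others ∘ there) (≈-trans (≈-sym drop-first) total)
      where
      drop-first : walkAscent h g (step d f refl W) ≈ walkAscent h g W
      drop-first = ≈-trans (walkAscent-step h g d f W)
        (≈-trans (+-≈ʳ (walkAscent h g W) (vanishes⇒ascent≈0 h g d f (others (here refl) (All.lookup f∉ e∈))))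
                 (≈-reflexive (ℤₚ.+-identityˡ (walkAscent h g W))))

    update : (Fin n → ℤ) → Fin n → ℤ → Fin n → ℤ
    update h u c x with x ≟ u
    ... | yes _ = c
    ... | no  _ = h x

    update-same : ∀ h u c → update h u c u ≡ c
    update-same h u c with u ≟ u
    ... | yes _  = refl
    ... | no u≢u = contradiction refl u≢u

    update-other : ∀ h {u x} c → x ≢ u → update h u c x ≡ h x
    update-other h {u} {x} c x≢u with x ≟ u
    ... | yes x≡u = contradiction x≡u x≢u
    ... | no  _   = refl

    -- The initial vertex of a path meets only the first edge, so its potential
    -- can be used to adjust the value on that edge alone.
    adjust-first : ∀ {w} d e (W : Walk G (terminal G d e) w) → IsPath (step d e refl W) → ∀ h g c →
      ∃ λ h′ → ascent h′ g d e ≡ c × All (λ f → value G φ h′ g f ≡ value G φ h g f) (edges W)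
    adjust-first d e W path h g c with path-tail-avoids d e W path
    ... | t≢u , avoid = h′ , on-e ,
      All.map (λ (s≢ , t≢) → cong₂ (λ t s → t -ℤ s +ℤ _) (update-other h z t≢) (update-other h z s≢)) avoid
      where
      u = initial G d e
      y = dot g (gain d e)
      -- The solution of `h (terminal G d e) -ℤ z +ℤ y ≡ c`, with `z` as the new potential of the
      -- initial vertex.
      z = h (terminal G d e) +ℤ y -ℤ c
      h′ = update h u z
      on-e : ascent h′ g d e ≡ c
      on-e rewrite update-same h u z | update-other h {u} z t≢u =
        solve 3 (λ t y c → t :- (t :+ y :- c) :+ y := c) refl (h (terminal G d e)) y c

    -- Potentials are fixed from the final vertex backwards, each new vertex absorbing the label of
    -- its edge. A path thus puts no constraint on `g`; only closing it up does.
    path-potential : ∀ {u w} (W : Walk G u w) → IsPath W → ∀ g → ∃ λ h → All (Vanishes G φ h g) (edges W)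
    path-potential stop path g = (λ _ → 0ℤ) , []
    path-potential (step d e refl W) path g
      with h , hW ← path-potential W (path-tail d e W path) g
      with h′ , on-e , same ← adjust-first d e W path h g 0ℤ
      = h′ , ascent≈0⇒vanishes h′ g d e (≈-reflexive on-e)
           ∷ All.zipWith (λ (eq , hf) → subst (+ p ∣_) (sym eq) hf) (same , hW)

    -- Changing the zero functional at the initial vertex alone yields one that is congruent to 0 on
    -- the later edges and to ±1 on the first, so the later edges do not span the first.
    path-independent : ∀ {u w} (W : Walk G u w) → IsPath W → listRank (edges W) ≡ length (edges W)
    path-independent stop path = refl
    path-independent (step d e refl W) path =
      cong₂ _+_ (jump-no (edges W ⊢? e) first∉) (path-independent W (path-tail d e W path))
      where
      first∉ : ¬ edges W ⊢ e
      first∉ W⊢e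
        with h , on-e , same ← adjust-first d e W path (λ _ → 0ℤ) (λ _ → 0ℤ) 1ℤ
        = 1≉0 (∣-resp-≈ (≈-reflexive on-e) (≈0⇒∣ (vanishes⇒ascent≈0 h (λ _ → 0ℤ) d e (W⊢e h (λ _ → 0ℤ)
            (All.map (λ {f} eq → subst (+ p ∣_) (sym eq) (zero-vanishes f)) same)))))
        where
        zero-vanishes : ∀ f → Vanishes G φ (λ _ → 0ℤ) (λ _ → 0ℤ) f
        zero-vanishes f = divides 0ℤ (trans (ℤₚ.+-identityˡ _) (dot-zeroˡ (φ f)))

    private
      M = matroid 𝓜

    cycle-rank-≥ : ∀ {v} (W : Walk G v v) → IsSimpleClosed W → ∣ edgeSet W ∣ ≤ suc (rank M (edgeSet W))
    cycle-rank-≥ stop (≢[] , _) = contradiction refl ≢[]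
    cycle-rank-≥ W@(step d e eq W′) (_ , vs! , _) = begin
      ∣ edgeSet W ∣             ≤⟨ ∣edgeSet∣≤length W ⟩
      suc (length (edges W′))   ≡⟨ cong suc (path-independent W′ (closed-tail-path d e W′ eq vs!)) ⟨
      suc (listRank (edges W′)) ≤⟨ s≤s (listRank-⊑ {edges W′} (∈-elements⁺ ∘ ∈-edgeSet⁺ W ∘ there)) ⟩
      suc (rank M (edgeSet W))  ∎
      where open ≤-Reasoning

    -- Around a closed walk of trivial gain each edge is spanned by the others, so deleting any edge
    -- `e` keeps the rank. As that rank is at least `∣ C ∣` - 1, every `C - e` is independent, and
    -- with it every proper subset.
    balanced-cycle⇒circuit : ∀ {v} (W : Walk G v v) → IsSimpleClosed W →
      walkLabel Γ φ W ≡ FiniteGroup.ε Γ → IsCircuit M (edgeSet W)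
    balanced-cycle⇒circuit {v} W simple@(≢[] , _ , es!) balanced = dependent W simple refl , proper
      where
      C = edgeSet W
      closed : ∀ h g → walkAscent h g W ≈ 0ℤ
      closed h g = +-≈ (≈-reflexive (ℤₚ.+-inverseʳ (h v)))
                       (subst (λ α → dot g α ≈ 0ℤ) (sym balanced) (dot-0 g))
      rank-minus : ∀ {e} → e Subset.∈ C → rank M C ≤ rank M (C - e)
      rank-minus {e} e∈C = listRank-closed {elements C} (All.tabulate spanned)
        where
        spanned : ∀ {f} → f ∈ elements C → elements (C - e) ⊢ f
        spanned {f} f∈ with f ≟ e
        ... | no f≢e   = ∈⇒⊢ (∈-elements⁺ (x∈p∧x≢y⇒x∈p-y (∈-elements⁻ C f∈) f≢e))
        ... | yes refl = λ h g hC → vanishes-on-last h g W es! (∈-edgeSet⁻ W e∈C)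
          (λ f∈W f≢e → All.lookup hC (∈-elements⁺ (x∈p∧x≢y⇒x∈p-y (∈-edgeSet⁺ W f∈W) f≢e))) (closed h g)
      -- The walk is passed again with an equation, so that its first edge can be exposed while `C`
      -- stays fixed.
      dependent : (W′ : Walk G v v) → IsSimpleClosed W′ → W′ ≡ W → rank M C < ∣ C ∣
      dependent stop (≢[] , _) _ = contradiction refl ≢[]
      dependent (step d e eq W′) _ refl = ≤-<-trans (≤-trans (rank-minus e∈) (Matroid.rank-≤-size M (C - e))) (x∈p⇒∣p-x∣<∣p∣ e∈)
        where e∈ : e Subset.∈ C
              e∈ = ∈-edgeSet⁺ W (here refl)
      proper : ∀ D → D ⊂ C → rank M D ≡ ∣ D ∣
      proper D (D⊆C , e , e∈C , e∉D) = ≤-antisym (Matroid.rank-≤-size M D)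
        (independent-⊆ M {D} {C - e} D⊆C-e (s≤s⁻¹ (≤-trans (x∈p⇒∣p-x∣<∣p∣ e∈C)
          (≤-trans (cycle-rank-≥ W simple) (s≤s (rank-minus e∈C))))))
        where
        D⊆C-e : D Subset.⊆ C - e
        D⊆C-e x∈D = x∈p∧x≢y⇒x∈p-y (D⊆C x∈D) (λ { refl → e∉D x∈D })

    -- Suppose the path left after the first edge spans that edge. For each coordinate `k`, some
    -- potential makes `δ k` vanish along the path, hence on the whole closed walk. The potentials
    -- cancel around it, leaving coordinate `k` of the gain, which is therefore zero.
    unbalanced-cycle-independent : ∀ {v} (W : Walk G v v) → IsSimpleClosed W →
      walkLabel Γ φ W ≢ FiniteGroup.ε Γ → ∣ edgeSet W ∣ ≤ rank M (edgeSet W)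
    unbalanced-cycle-independent stop (≢[] , _) _ = contradiction refl ≢[]
    unbalanced-cycle-independent {v} W@(step d e refl W′) (_ , vs! , _) unbalanced = begin
      ∣ edgeSet W ∣               ≤⟨ ∣edgeSet∣≤length W ⟩
      suc (length (edges W′))     ≡⟨ cong₂ _+_ (jump-no (edges W′ ⊢? e) first∉) (path-independent W′ path) ⟨
      listRank (e ∷ edges W′)     ≤⟨ listRank-⊑ {edges W} (∈-elements⁺ ∘ ∈-edgeSet⁺ W) ⟩
      rank M (edgeSet W)          ∎
      where
      open ≤-Reasoning
      path = closed-tail-path d e W′ refl vs!
      first∉ : ¬ edges W′ ⊢ e
      first∉ W′⊢e = unbalanced (lookup-ext λ k → ∣toℕ⇒≡0ₚ _ (coordinate k))
        where
        total : Vec (Fin p) j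
        total = walkLabel Γ φ W
        coordinate : ∀ k → + p ∣ + toℕ (lookup total k)
        coordinate k with h , hW′ ← path-potential W′ path (δ k)
          = ≈0⇒∣ (subst (_≈ 0ℤ) (trans (cong (_+ℤ dot (δ k) total) (ℤₚ.+-inverseʳ (h v))) (trans (ℤₚ.+-identityˡ _) (dot-δ k total)))
              (walkAscent≈0 h (δ k) W (W′⊢e h (δ k) hW′ ∷ hW′)))
        lookup-ext : ∀ {j} {v : Vec (Fin p) j} → (∀ k → lookup v k ≡ 0ₚ p) → v ≡ replicate j (0ₚ p)
        lookup-ext {v = []}    eq = refl
        lookup-ext {v = x ∷ v} eq = cong₂ _∷_ (eq zero) (lookup-ext (eq ∘ suc))

-- Circuits of the graphic matroid

module _ {n m : ℕ} (G : Multigraph n m) where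
  open Multigraph G

  Adjacent : List (Fin m) → Fin n → Fin n → Set
  Adjacent l x y = ∃ λ f → f ∈ l × source f ≡ x × target f ≡ y

  Connected : List (Fin m) → Fin n → Fin n → Set
  Connected l = EqClosure (Adjacent l)

  private
    redirect : Fin n → Fin n → Fin n → Fin n
    redirect x y z with z ≟ x
    ... | yes _ = y
    ... | no  _ = z

    redirect-identifies : ∀ x y → redirect x y x ≡ redirect x y y
    redirect-identifies x y with x ≟ x | y ≟ x
    ... | yes _ | yes _ = refl
    ... | yes _ | no  _ = refl
    ... | no ≢x | _     = contradiction refl ≢x

  -- Union–find: each edge of l merges the component of its source into that
  -- of its target.
  component : List (Fin m) → Fin n → Fin n
  component []      x = x
  component (f ∷ l) x = redirect (component l (source f)) (component l (target f)) (component l x)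

  component-edge : ∀ {l f} → f ∈ l → component l (source f) ≡ component l (target f)
  component-edge {f ∷ l} (here refl) = redirect-identifies (component l (source f)) (component l (target f))
  component-edge {g ∷ l} (there f∈l) =
    cong (redirect (component l (source g)) (component l (target g))) (component-edge f∈l)

  private
    connected-there : ∀ {l f x y} → Connected l x y → Connected (f ∷ l) x y
    connected-there ε = ε
    connected-there (fwd (g , g∈l , ends) ◅ c) = fwd (g , there g∈l , ends) ◅ connected-there c
    connected-there (bwd (g , g∈l , ends) ◅ c) = bwd (g , there g∈l , ends) ◅ connected-there c

  component-connected : ∀ l x → Connected l x (component l x)
  component-connected []      x = ε
  component-connected (f ∷ l) x with component l x ≟ component l (source f)
  ... | no _   = connected-there (component-connected l x)
  ... | yes eq =
    transitive _ (connected-there (subst (Connected l x) eq (component-connected l x)))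
    (transitive _ (symmetric _ (connected-there (component-connected l (source f))))
                  (fwd (f , here refl , refl , refl) ◅ connected-there (component-connected l (target f))))

  same-component⇒connected : ∀ l {x y} → component l x ≡ component l y → Connected l x y
  same-component⇒connected l {x} {y} eq = transitive _ (subst (Connected l x) eq (component-connected l x))
                                                  (symmetric _ (component-connected l y))

  record SimplePath (l : List (Fin m)) (u w : Fin n) : Set where
    field
      walk         : Walk G u w
      isPath       : IsPath walk
      edges-unique : Unique (edges walk)
      edges⊑       : edges walk ⊑ l

  open SimplePath

  stopPath : ∀ {l u} → SimplePath l u u
  stopPath = record { walk = stop ; isPath = [] , (λ ()) ; edges-unique = [] ; edges⊑ = λ () }

  pathFrom : ∀ {l u w x} (P : SimplePath l u w) → x ∈ vertices (walk P) → SimplePath l x w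
  pathFrom {l} {x = x} P = go (walk P) (isPath P) (edges-unique P) (edges⊑ P)
    where
    go : ∀ {u w} (W : Walk G u w) → IsPath W → Unique (edges W) → edges W ⊑ l → x ∈ vertices W → SimplePath l x w
    go W@(step _ _ _ _) path es! ⊑l (here refl) =
      record { walk = W ; isPath = path ; edges-unique = es! ; edges⊑ = ⊑l }
    go (step d e refl W) path (_ ∷ es!) ⊑l (there x∈) = go W (path-tail d e W path) es! (⊑l ∘ there) x∈

  -- Loop erasure: if the new vertex already lies on the path, the path is cut there instead of
  -- extended. Otherwise no edge of the path meets that vertex, so `e` is new as well.
  prepend : ∀ {l w} d e → e ∈ l → SimplePath l (terminal G d e) w → SimplePath l (initial G d e) w
  prepend {l} {w} d e e∈l P with initial G d e ≟ w
  ... | yes refl = stopPath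
  ... | no u≢w with Any.any? (initial G d e ≟_) (vertices (walk P))
  ...   | yes u∈ = pathFrom P u∈
  ...   | no  u∉ = record
    { walk         = step d e refl (walk P)
    ; isPath       = All.tabulate (λ x∈ u≡x → u∉ (subst (_∈ vertices (walk P)) (sym u≡x) x∈)) ∷ proj₁ (isPath P)
                   , λ { (here w≡u) → u≢w (sym w≡u) ; (there w∈) → proj₂ (isPath P) w∈ }
    ; edges-unique = All.tabulate (λ f∈ e≡f → e∉ (subst (_∈ edges (walk P)) (sym e≡f) f∈)) ∷ edges-unique P
    ; edges⊑       = λ { (here refl) → e∈l ; (there f∈) → edges⊑ P f∈ }
    }
    where
    e∉ : ¬ e ∈ edges (walk P)
    e∉ e∈ = meets d refl (All.lookup (edges-avoid (walk P) u∉ u≢w) e∈)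
      where
      meets : ∀ d′ → d′ ≡ d → ¬ (source e ≢ initial G d e × target e ≢ initial G d e)
      meets forward  refl (s≢ , _) = s≢ refl
      meets backward refl (_ , t≢) = t≢ refl

  connected⇒path : ∀ {l x y} → Connected l x y → SimplePath l x y
  connected⇒path ε = stopPath
  connected⇒path (fwd (f , f∈l , refl , refl) ◅ c) = prepend forward  f f∈l (connected⇒path c)
  connected⇒path (bwd (f , f∈l , refl , refl) ◅ c) = prepend backward f f∈l (connected⇒path c)

-- The cycle matroid and its gain lifts

module CycleMatroid {p : ℕ} (p-prime : Prime p) {n m : ℕ} (G : Multigraph n m) where
  open Gains p-prime
  open GainWalks p-prime
  open Multigraph G

  private instance _ = prime⇒nonZero p-prime

  -- For the trivial group ℤₚ⁰ the gain matroid is the cycle matroid.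
  trivial : Fin m → Vec (Fin p) 0
  trivial _ = []

  graphicClosure : ClosureSpace (Fin m)
  graphicClosure = gainClosure G trivial

  graphic : Matroid m
  graphic = matroid graphicClosure

  open ClosureSpace graphicClosure

  cycle⇒circuit : ∀ {v} (W : Walk G v v) → IsSimpleClosed W → IsCircuit graphic (edgeSet W)
  cycle⇒circuit W simple = balanced-cycle⇒circuit {φ = trivial} W simple (all-equal _ _)
    where
    all-equal : (x y : Vec (Fin p) 0) → x ≡ y
    all-equal [] [] = refl

  -- The indicator of the component of `source e` is constant along every edge of `l`, so it
  -- vanishes on `l`. On `e` its value would be -1 if the ends lay in different components.
  spanned⇒connected : ∀ {l e} → l ⊢ e → Connected G l (target e) (source e)
  spanned⇒connected {l} {e} l⊢e with component G l (target e) ≟ component G l (source e)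
  ... | yes eq = same-component⇒connected G l eq
  ... | no neq = contradiction (∣m⇒∣-m (subst (+ p ∣_) value-e (l⊢e h (λ ()) (All.tabulate h-vanishes)))) 1≉0
    where
    indicator : Fin n → ℤ
    indicator x with x ≟ component G l (source e)
    ... | yes _ = 1ℤ
    ... | no _  = 0ℤ
    h : Fin n → ℤ
    h x = indicator (component G l x)
    h-vanishes : ∀ {f} → f ∈ l → Vanishes G trivial h (λ ()) f
    h-vanishes {f} f∈l = divides 0ℤ (trans (ℤₚ.+-identityʳ _)
      (trans (cong (λ x → indicator x -ℤ h (source f)) (sym (component-edge G f∈l))) (ℤₚ.+-inverseʳ (h (source f)))))
    value-e : value G trivial h (λ ()) e ≡ -ℤ 1ℤ
    value-e with component G l (target e) ≟ component G l (source e) | component G l (source e) ≟ component G l (source e)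
    ... | yes eq | _       = contradiction eq neq
    ... | no _   | yes _   = refl
    ... | no _   | no neq′ = contradiction refl neq′

  -- Some edge of `C` is spanned by others, hence closed up to a cycle by a path among them. That
  -- cycle lies in `C` and is dependent, so minimality of `C` makes the two equal.
  circuit⇒cycle : ∀ {C} → IsCircuit graphic C → IsCycle G C
  circuit⇒cycle {C} (dep , proper) = close
    (dependent⇒⊢ {elements C} (elements-unique C) (<-≤-trans dep (≤-reflexive (sym (length-elements C)))))
    where
    close : (∃ λ e → ∃ λ k → e ∈ elements C × k ⊑ elements C × ¬ e ∈ k × k ⊢ e) → IsCycle G C
    close (e , k , e∈C , k⊑C , e∉k , k⊢e) = source e , W , simple , Subsetₚ.⊆-antisym W⊆C C⊆W
      where
      open SimplePath (connected⇒path G (spanned⇒connected k⊢e))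
      W : Walk G (source e) (source e)
      W = step forward e refl walk
      simple : IsSimpleClosed W
      simple = (λ ()) , All.tabulate (λ x∈ s≡x → proj₂ isPath (subst (_∈ vertices walk) (sym s≡x) x∈)) ∷ proj₁ isPath
             , All.tabulate (λ f∈ e≡f → e∉k (edges⊑ (subst (_∈ edges walk) (sym e≡f) f∈))) ∷ edges-unique
      W⊆C : edgeSet W Subset.⊆ C
      W⊆C f∈ with ∈-edgeSet⁻ W f∈
      ... | here refl = ∈-elements⁻ C e∈C
      ... | there f∈P = ∈-elements⁻ C (k⊑C (edges⊑ f∈P))
      C⊆W : C Subset.⊆ edgeSet W
      C⊆W {x} x∈C with x Subsetₚ.∈? edgeSet W
      ... | yes x∈W = x∈W
      ... | no  x∉W = contradiction (proper (edgeSet W) (W⊆C , x , x∈C , x∉W)) (<⇒≢ (proj₁ (cycle⇒circuit W simple)))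

  graphic-isCycleMatroid : IsCycleMatroid G graphic
  graphic-isCycleMatroid C = mk⇔ (circuit⇒cycle {C}) λ { (v , W , simple , refl) → cycle⇒circuit W simple }

  module _ {j : ℕ} (φ : Fin m → Vec (Fin p) j) where
    private
      Γ = ℤₚ^ p j
      lifted : Matroid m
      lifted = matroid (gainClosure G φ)

    -- A graphic functional is a gain functional with zero label part, so graphic span is tested by
    -- fewer functionals.
    gain⇛graphic : gainClosure G φ ⇛ graphicClosure
    gain⇛graphic {l} {e} l⊢e h g hl =
      subst (+ p ∣_) (same e) (l⊢e h (λ _ → 0ℤ) (All.map (λ {f} → subst (+ p ∣_) (sym (same f))) hl))
      where
      same : ∀ f → value G φ h (λ _ → 0ℤ) f ≡ value G trivial h g f
      same f = cong (h (target f) -ℤ h (source f) +ℤ_) (dot-zeroˡ (φ f))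

    quotient : IsQuotient graphic lifted
    quotient {X} {Y} = matroid-quotient {𝓜 = gainClosure G φ} {graphicClosure} gain⇛graphic {X} {Y}

    gainLift : ℕ → Matroid m
    gainLift = higgs graphic lifted quotient

    gainLift-circuit⇔balanced : ∀ i → 1 ≤ i → ∀ C → IsCycle G C → IsCircuit (gainLift i) C ⇔ IsBalanced Γ G φ C
    gainLift-circuit⇔balanced i 1≤i C (v , W , simple , refl) = mk⇔ to from
      where
      to : IsCircuit (gainLift i) C → IsBalanced Γ G φ C
      to circuit = decide (Vecₚ.≡-dec _≟_ (walkLabel Γ φ W) (FiniteGroup.ε Γ))
        where
        decide : Dec (walkLabel Γ φ W ≡ FiniteGroup.ε Γ) → IsBalanced Γ G φ C
        decide (yes balanced)  = v , W , (simple , refl) , balanced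
        decide (no unbalanced) = contradiction circuit (higgs-non-circuit {N = graphic} {lifted} quotient 1≤i C
          (cycle-rank-≥ {φ = trivial} W simple) (unbalanced-cycle-independent {φ = φ} W simple unbalanced))
      from : IsBalanced Γ G φ C → IsCircuit (gainLift i) C
      from (v′ , W′ , (simple′ , eq) , balanced) =
        -- The cycle and its balance may come from different walks, `W` and `W′`; their edge sets
        -- agree by `eq`.
        higgs-circuit {N = graphic} {lifted} quotient i C (cycle⇒circuit W simple)
          (subst (IsCircuit lifted) eq (balanced-cycle⇒circuit {φ = φ} W′ simple′ balanced))

    gainLift-isRankLift : ∀ i → rank graphic Subset.⊤ + i ≤ rank lifted Subset.⊤ → IsRankLift i (gainLift i) graphic
    gainLift-isRankLift i i≤ = higgs-isLift {N = graphic} {lifted} quotient i , higgs-full {N = graphic} {lifted} quotient i i≤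

    gainLifts : rank graphic Subset.⊤ + j ≤ rank lifted Subset.⊤ → ∀ i → 1 ≤ i → i ≤ j →
      Σ (Matroid m) λ M → IsRankLift i M graphic × (∀ C → IsCycle G C → IsCircuit M C ⇔ IsBalanced Γ G φ C)
    gainLifts full i 1≤i i≤j = gainLift i
      , gainLift-isRankLift i (≤-trans (+-monoʳ-≤ (rank graphic Subset.⊤) i≤j) full)
      , gainLift-circuit⇔balanced i 1≤i

-- Rank of the full gain matroid

module _ {p : ℕ} (p-prime : Prime p) where
  open Gains p-prime
  open GainWalks p-prime
  private instance _ = prime⇒nonZero p-prime

  unit : ∀ {j} → Fin j → Vec (Fin p) j
  unit {j} k = replicate j (0ₚ p) [ k ]≔ mod p 1

  -- What the rank count asks of the graph: a parallel edge of trivial label for every edge, and an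
  -- edge carrying each unit vector.
  module _
    {n m j : ℕ} (G : Multigraph n m) (φ : Fin m → Vec (Fin p) j)
    (neutral  : ∀ e → ∃ λ z → Multigraph.source G z ≡ Multigraph.source G e × Multigraph.target G z ≡ Multigraph.target G e
                            × φ z ≡ replicate j (0ₚ p))
    (unitEdge : Fin j → Fin m)
    (φ-unit   : ∀ k → φ (unitEdge k) ≡ unit k)
    where
    open CycleMatroid p-prime G
    open ClosureSpace

    private
      zeroLabel : Vec (Fin p) j
      zeroLabel = replicate j (0ₚ p)

      𝓜 = gainClosure G φ

      zeroLabel? : ∀ e → Dec (φ e ≡ zeroLabel)
      zeroLabel? e = Vecₚ.≡-dec _≟_ (φ e) zeroLabel

      zeroEdges : List (Fin m)
      zeroEdges = filter zeroLabel? (elements Subset.⊤)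

      zeroEdges-span : ∀ e → _⊢_ graphicClosure zeroEdges e
      zeroEdges-span e h g hZ = let z , s≡ , t≡ , φz = neutral e in
        subst (+ p ∣_) (cong₂ (λ t s → h t -ℤ h s +ℤ 0ℤ) t≡ s≡)
          (All.lookup hZ (∈-filter⁺ zeroLabel? (∈-elements⁺ ∈⊤) φz))

      value-δ : ∀ k e → value G φ (λ _ → 0ℤ) (δ k) e ≡ + toℕ (lookup (φ e) k)
      value-δ k e = trans (ℤₚ.+-identityˡ _) (dot-δ k (φ e))

      -- The functional with zero potential and label part `δ k` reads off coordinate `k`: it is 1
      -- modulo `p` on the `k`-th unit edge and 0 on the other unit edges and on the neutral ones.
      unitEdge∉ : ∀ {k ks} → All (k ≢_) ks → ¬ _⊢_ 𝓜 (map unitEdge ks ++ zeroEdges) (unitEdge k)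
      unitEdge∉ {k} {ks} k∉ ⊢k =
        1≉0 (∣-resp-≈ (≈-trans (≈-reflexive at-k) (mod-≈ 1)) (⊢k (λ _ → 0ℤ) (δ k) (Allₚ.++⁺ on-units on-zeros)))
        where
        at-k : value G φ (λ _ → 0ℤ) (δ k) (unitEdge k) ≡ + toℕ (mod p 1)
        at-k = trans (value-δ k (unitEdge k)) (cong (λ x → + toℕ x)
          (trans (cong (λ α → lookup α k) (φ-unit k)) (lookup∘update k zeroLabel (mod p 1))))
        vanishes : ∀ e → lookup (φ e) k ≡ 0ₚ p → Vanishes G φ (λ _ → 0ℤ) (δ k) e
        vanishes e eq = ≈0⇒∣ (≈-trans (≈-reflexive (trans (value-δ k e) (cong (λ x → + toℕ x) eq))) (mod-≈ 0))
        on-units : All (Vanishes G φ (λ _ → 0ℤ) (δ k)) (map unitEdge ks)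
        on-units = Allₚ.map⁺ (All.map (λ {l} k≢l → vanishes (unitEdge l)
          (trans (cong (λ α → lookup α k) (φ-unit l))
                 (trans (lookup∘update′ k≢l zeroLabel (mod p 1)) (lookup-replicate k (0ₚ p))))) k∉)
        on-zeros : All (Vanishes G φ (λ _ → 0ℤ) (δ k)) zeroEdges
        on-zeros = All.tabulate λ {e} e∈ → vanishes e
          (trans (cong (λ α → lookup α k) (proj₂ (∈-filter⁻ zeroLabel? {xs = elements Subset.⊤} e∈)))
                 (lookup-replicate k (0ₚ p)))

    -- The neutral edges already have full graphic rank, and each of the j unit
    -- edges is independent of them and of the other unit edges.
    gain-rank-full : rank graphic Subset.⊤ + j ≤ rank (matroid 𝓜) Subset.⊤
    gain-rank-full = begin
      rank graphic Subset.⊤ + j                          ≤⟨ +-monoˡ-≤ j (listRank-closed graphicClosure {elements Subset.⊤} (All.tabulate λ {e} _ → zeroEdges-span e)) ⟩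
      listRank graphicClosure zeroEdges + j              ≤⟨ +-monoˡ-≤ j (listRank-⇛ {𝓜 = 𝓜} {graphicClosure} (gain⇛graphic φ) zeroEdges) ⟩
      listRank 𝓜 zeroEdges + j                           ≡⟨ +-comm _ j ⟩
      j + listRank 𝓜 zeroEdges                           ≡⟨ cong (_+ listRank 𝓜 zeroEdges) (length-tabulate {n = j} (λ k → k)) ⟨
      length (allFin j) + listRank 𝓜 zeroEdges           ≡⟨ listRank-map-++ 𝓜 unitEdge unitEdge∉ (Uniqueₚ.allFin⁺ j) ⟨
      listRank 𝓜 (map unitEdge (allFin j) ++ zeroEdges)  ≤⟨ listRank-⊑ 𝓜 {map unitEdge (allFin j) ++ zeroEdges} (λ _ → ∈-elements⁺ ∈⊤) ⟩
      rank (matroid 𝓜) Subset.⊤                          ∎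
      where open ≤-Reasoning

    graphic-lifts : Σ (Matroid m) λ N → IsCycleMatroid G N ×
      ((i : ℕ) → 1 ≤ i → i ≤ j → Σ (Matroid m) λ M →
        IsRankLift i M N × (∀ C → IsCycle G C → IsCircuit M C ⇔ IsBalanced (ℤₚ^ p j) G φ C))
    graphic-lifts = graphic , graphic-isCycleMatroid , gainLifts φ gain-rank-full

-- Application to the complete gain graph

theorem1p3 : (p : ℕ) (p-prime : Prime p) (n j : ℕ) → 3 ≤ n → 2 ≤ j →
    let Γ = ℤₚ^ p {{prime⇒nonZero p-prime}} j in
    Σ (Matroid (edgeCount n Γ)) λ N →
    IsCycleMatroid (K n Γ) N ×
    ((i : ℕ) → 1 ≤ i → i ≤ j →
    Σ (Matroid (edgeCount n Γ)) λ M →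
    IsRankLift i M N ×
    (∀ C → IsCycle (K n Γ) C →
    (IsCircuit M C ⇔ IsBalanced Γ (K n Γ) (label n Γ) C)))
theorem1p3 p p-prime n j 3≤n _ =
  graphic-lifts p-prime (K n Γ) (label n Γ) neutralEdge
    (λ k → edgeOf (firstPair 3≤n , unit p-prime k)) (λ k → cong proj₂ (edge-edgeOf (firstPair 3≤n , unit p-prime k)))
  where
  instance _ = prime⇒nonZero p-prime
  Γ = ℤₚ^ p j
  open Multigraph (K n Γ)

  -- One pair of vertices carries all `j` unit labels: the unit edges are told apart by their labels
  -- alone, so they may be parallel.
  firstPair : ∀ {n} → 3 ≤ n → Pair n
  firstPair (s≤s (s≤s _)) = (zero , suc zero) , s≤s z≤n

  edgeOf : Edge n Γ → Fin (edgeCount n Γ)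
  edgeOf = Inverse.from (edgeNumbering n Γ)

  edge-edgeOf : ∀ x → edge n Γ (edgeOf x) ≡ x
  edge-edgeOf x = Inverse.inverseˡ (edgeNumbering n Γ) refl

  neutralEdge : ∀ e → ∃ λ z → source z ≡ source e × target z ≡ target e × label n Γ z ≡ replicate j (0ₚ p)
  neutralEdge e = edgeOf x , cong (proj₁ ∘ proj₁ ∘ proj₁) eq , cong (proj₂ ∘ proj₁ ∘ proj₁) eq , cong proj₂ eq
    where
    x : Edge n Γ
    x = proj₁ (edge n Γ e) , replicate j (0ₚ p)
    eq : edge n Γ (edgeOf x) ≡ x
    eq = edge-edgeOf x
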